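{- Assume $C\succ 0$ and $A_1,\dots,A_m$ are linearly independent. Let $X(t)$ be a differentiable solution of the second-ansatz dynamics $$\mathrm{vec}(\dot X) = -\bigl(I - G\mathcal{A}^T(\mathcal{A}G\mathcal{A}^T)^{ -1} \mathcal{A}\bigr)G\,\mathrm{vec}(C),\qquad G=X\otimes X,$$ with $X(0)\succ 0$ linearly feasible. Then $X(t)\succ 0$ for every finite time $t\ge 0$ (and $X(t)$ remains linearly feasible).
   Context: We consider the SDP $\min\{\mathrm{tr}(CX): \mathrm{tr}(A_\ell X)=b_\ell\ \forall\ell\in[m],\ X\succeq 0\}$ with symmetric $n\times n$ matrices $C,A_1,\dots,A_m$ and $b\in\mathbb{R}^m$. For an $n\times n$ matrix $M$, $\mathrm{vec}(M)\in\mathbb{R}^{n^2}$ is obtained by stacking the columns of $M$; $\otimes$ is the Kronecker product. $\mathcal{A}$ is the $m\times n^2$ matrix whose $\ell$-th row is $\mathrm{vec}(A_\ell)^T$. A matrix $X$ is linearly feasible if $\mathcal{A}\,\mathrm{vec}(X)=b$. -}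

module Defs where

open import Algebra.Bundles using (CommutativeRing)
open import Algebra.Core using (Op₁; Op₂)
import Algebra.Properties.CommutativeMonoid.Sum as Summation
open import Algebra.Structures using (IsCommutativeRing)
open import Data.Bool.Base using (if_then_else_)
open import Data.Fin.Base using (Fin; quotient; remainder)
open import Data.Fin.Properties using (_≟_)
open import Data.Nat.Base as ℕ using (ℕ)
open import Data.Product.Base using (_×_; ∃-syntax)
open import Data.Vec.Functional using (Vector)
import Data.Vec.Functional.Relation.Binary.Equality.Setoid as VectorEquality
open import Level using (0ℓ)
open import Relation.Binary.Core using (Rel)
import Relation.Binary.Construct.StrictToNonStrict as NonStrict
open import Relation.Binary.Structures using (IsStrictTotalOrder)
open import Relation.Nullary using (¬_; does)

-- The library has no real numbers.  A real number field is taken to be any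
-- model of the usual axioms of ℝ (a Dedekind-complete ordered field), which
-- classically determine it up to unique isomorphism.  As for all of the
-- library's algebra, equality is a setoid equality _≈_, and the order is total
-- in the strong (decidable) sense of the classical axioms.
record RealField : Set₁ where
  infix  8 -_
  infixl 7 _*_
  infixl 6 _+_
  infix  4 _≈_ _<_

  field
    Carrier : Set
    _≈_     : Rel Carrier 0ℓ
    _<_     : Rel Carrier 0ℓ
    _+_     : Op₂ Carrier
    _*_     : Op₂ Carrier
    -_      : Op₁ Carrier
    0#      : Carrier
    1#      : Carrier

    isCommutativeRing  : IsCommutativeRing _≈_ _+_ _*_ -_ 0# 1#
    1≉0                : ¬ (1# ≈ 0#)
    inverse            : ∀ x → ¬ (x ≈ 0#) → ∃[ y ] x * y ≈ 1#
    isStrictTotalOrder : IsStrictTotalOrder _≈_ _<_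
    +-monoˡ-<          : ∀ {x y} z → x < y → x + z < y + z
    *-pos              : ∀ {x y} → 0# < x → 0# < y → 0# < x * y

  open NonStrict _≈_ _<_ public using (_≤_)

  IsUpperBound : (Carrier → Set) → Carrier → Set
  IsUpperBound P b = ∀ x → P x → x ≤ b

  field
    supremum : (P : Carrier → Set) → ∃[ x ] P x → ∃[ b ] IsUpperBound P b →
               ∃[ s ] IsUpperBound P s × (∀ b → IsUpperBound P b → s ≤ b)

  commutativeRing : CommutativeRing 0ℓ 0ℓ
  commutativeRing = record { isCommutativeRing = isCommutativeRing }

  open CommutativeRing commutativeRing public
    using (_-_; setoid; +-commutativeMonoid)
  open IsStrictTotalOrder isStrictTotalOrder public
    using (compare; _<?_)

  infix 8 ∣_∣

  ∣_∣ : Carrier → Carrier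
  ∣ x ∣ = if does (x <? 0#) then - x else x

module OverReals (ℝ : RealField) where

  open RealField ℝ public
  open Summation +-commutativeMonoid public using (sum)
  open VectorEquality setoid public using (_≋_)

  infix  9 _ᵀ
  infixl 8 _⊗_
  infixl 7 _∙_ _*ₘ_
  infixr 7 _*ᵥ_
  infixl 6 _-ₘ_
  infix  4 _≈ₘ_

  Matrix : ℕ → ℕ → Set
  Matrix m n = Fin m → Fin n → Carrier

  _≈ₘ_ : ∀ {m n} → Rel (Matrix m n) 0ℓ
  M ≈ₘ N = ∀ i → M i ≋ N i

  0ᵥ : ∀ {n} → Vector Carrier n
  0ᵥ _ = 0#

  0ₘ : ∀ {m n} → Matrix m n
  0ₘ _ _ = 0#

  -ᵥ_ : ∀ {n} → Vector Carrier n → Vector Carrier n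
  (-ᵥ v) i = - v i

  _∙_ : ∀ {n} → Vector Carrier n → Vector Carrier n → Carrier
  u ∙ v = sum (λ i → u i * v i)

  _ᵀ : ∀ {m n} → Matrix m n → Matrix n m
  (M ᵀ) i j = M j i

  Id : ∀ {n} → Matrix n n
  Id i j = if does (i ≟ j) then 1# else 0#

  _-ₘ_ : ∀ {m n} → Matrix m n → Matrix m n → Matrix m n
  (M -ₘ N) i j = M i j - N i j

  _*ₘ_ : ∀ {m n p} → Matrix m n → Matrix n p → Matrix m p
  (M *ₘ N) i k = sum (λ j → M i j * N j k)

  _*ᵥ_ : ∀ {m n} → Matrix m n → Vector Carrier n → Vector Carrier m
  (M *ᵥ v) i = M i ∙ v

  IsInverse : ∀ {n} → Matrix n n → Matrix n n → Set
  IsInverse M N = (M *ₘ N ≈ₘ Id) × (N *ₘ M ≈ₘ Id)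

  -- Index k of Fin (n * n) is  quotient * n + remainder;  column stacking makes
  -- the quotient the column and the remainder the row.
  vec : ∀ {n} → Matrix n n → Vector Carrier (n ℕ.* n)
  vec {n} M k = M (remainder {n} n k) (quotient n k)

  -- Entry (i * p + k , j * q + l) is M i j * N k l.
  _⊗_ : ∀ {m n p q} → Matrix m n → Matrix p q → Matrix (m ℕ.* p) (n ℕ.* q)
  _⊗_ {m} {n} {p} {q} M N r s =
    M (quotient p r) (quotient q s) * N (remainder {m} p r) (remainder {n} q s)

  IsSymmetric : ∀ {n} → Matrix n n → Set
  IsSymmetric M = M ᵀ ≈ₘ M

  -- M ≻ 0
  PositiveDefinite : ∀ {n} → Matrix n n → Set
  PositiveDefinite M =
    IsSymmetric M × (∀ v → ¬ (v ≋ 0ᵥ) → 0# < v ∙ (M *ᵥ v))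

  LinearlyIndependent : ∀ {m n} → (Fin m → Matrix n n) → Set
  LinearlyIndependent A =
    ∀ c → (λ i j → sum (λ ℓ → c ℓ * A ℓ i j)) ≈ₘ 0ₘ → c ≋ 0ᵥ

  constraintMatrix : ∀ {m n} → (Fin m → Matrix n n) → Matrix m (n ℕ.* n)
  constraintMatrix A ℓ = vec (A ℓ)

  LinearlyFeasible : ∀ {m n} → (Fin m → Matrix n n) → Vector Carrier m →
                     Matrix n n → Set
  LinearlyFeasible A b X = constraintMatrix A *ᵥ vec X ≋ b

  -- An interval of existence for an initial value problem posed at time 0:
  -- [0,∞), [0,T) or [0,T].
  record IsTimeInterval (J : Carrier → Set) : Set where
    field
      start      : J 0#
      nonneg     : ∀ {t} → J t → 0# ≤ t
      downClosed : ∀ {s t} → 0# ≤ s → s ≤ t → J t → J s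

  -- Derivative relative to J, hence one-sided at an endpoint of J.  The bound is
  -- multiplied out, so it also covers s ≈ t, where it only says f s ≈ f t.
  HasDerivativeWithin : (Carrier → Set) → (Carrier → Carrier) →
                        Carrier → Carrier → Set
  HasDerivativeWithin J f t f′ =
    ∀ ε → 0# < ε → ∃[ δ ] 0# < δ ×
      (∀ s → J s → ∣ s - t ∣ < δ →
        ∣ f s - f t - f′ * (s - t) ∣ ≤ ε * ∣ s - t ∣)

  -- The right-hand side  −(I − G𝒜ᵀ K 𝒜) G vec(C),  with K in the place of
  -- (𝒜G𝒜ᵀ)⁻¹.
  ansatzRHS : ∀ {m N} → Matrix m N → Matrix N N → Matrix m m →
              Vector Carrier N → Vector Carrier N
  ansatzRHS 𝒜 G K c = -ᵥ ((Id -ₘ G *ₘ 𝒜 ᵀ *ₘ K *ₘ 𝒜) *ᵥ G *ᵥ c)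

  -- To solve the equation on J includes that its right-hand side makes sense
  -- there, i.e. that 𝒜G𝒜ᵀ is invertible at every time in J.
  record IsSolution {m n} (C : Matrix n n) (A : Fin m → Matrix n n)
                    (J : Carrier → Set) (X : Carrier → Matrix n n) : Set where
    𝒜 : Matrix m (n ℕ.* n)
    𝒜 = constraintMatrix A

    G : Carrier → Matrix (n ℕ.* n) (n ℕ.* n)
    G t = X t ⊗ X t

    field
      Ẋ              : Carrier → Matrix n n
      differentiable : ∀ t → J t → ∀ i j →
                       HasDerivativeWithin J (λ s → X s i j) t (Ẋ t i j)
      equation       : ∀ t → J t →
                       ∃[ K ] IsInverse (𝒜 *ₘ G t *ₘ 𝒜 ᵀ) K ×
                              vec (Ẋ t) ≋ ansatzRHS 𝒜 (G t) K (vec C)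

{-# OPTIONS --safe #-}
module Submission where

open import Defs
open import Algebra.Bundles using (CommutativeRing)
import Algebra.Properties.AbelianGroup as AbelianGroupProperties
import Algebra.Properties.Ring as RingProperties
import Algebra.Properties.Semiring.Mult.TCOptimised as Multiples
import Algebra.Properties.Semiring.Sum as SemiringSum
import Algebra.Solver.Ring as RingSolver
open import Algebra.Solver.Ring.AlmostCommutativeRing
  using (fromCommutativeRing; _-Raw-AlmostCommutative⟶_)
open import Data.Fin.Base
  using (Fin; zero; suc; combine; quotient; remainder; _↑ˡ_; _↑ʳ_)
open import Data.Fin.Properties using (remQuot-combine)
open import Data.Integer.Base as ℤ using (ℤ; +_; -[1+_]; _⊖_)
import Data.Integer.Properties as ℤ
open import Data.Maybe.Base as Maybe using (Maybe)
open import Data.Nat.Base as ℕ using (ℕ; zero; suc)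
open import Data.Nat.Properties using (+-suc)
open import Data.Product.Base using (_×_; _,_; proj₁; proj₂; ∃; ∃-syntax)
open import Data.Sum.Base using (_⊎_; inj₁; inj₂; [_,_]′)
open import Data.Vec.Functional using (Vector; _∷_)
open import Function.Base using (_∘_)
import Relation.Binary.Construct.StrictToNonStrict as NonStrict
open import Relation.Binary.Definitions using (Tri; tri<; tri≈; tri>)
open import Relation.Binary.PropositionalEquality.Core as ≡ using (_≡_)
import Relation.Binary.Reasoning.Setoid as SetoidReasoning
open import Relation.Binary.Structures using (IsStrictTotalOrder; module IsDecTotalOrder)
open import Relation.Nullary using (¬_; yes; no; contradiction)
open import Relation.Nullary.Decidable.Core using (dec⇒maybe; decidable-stable)

-- With K = (𝒜G𝒜ᵀ)⁻¹, the dynamics read Ẋ = - X S Xᵀ for the symmetric matrix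
-- S = C - Σ y_ℓ A_ℓ, y = K𝒜G vec(C), and 𝒜 vec(Ẋ) = 0.  Hence X - Xᵀ and
-- 𝒜 vec(X) are constant: X stays symmetric and linearly feasible.
-- The set of times up to which X is positive definite is open, since a definite
-- form is coercive.  It is also closed: at a limit time τ the form of X(τ) is
-- semidefinite, so v·X(τ)v = 0 forces X(τ)v = 0; but u = Xv solves the linear
-- equation u̇ = - X S u, whose coefficients are bounded near τ, so u vanishes
-- already before τ, where X is definite.

-- The delicate point is that the coefficients are bounded near τ. Only X is known to be continuous;
-- K and Ẋ are merely given at each time. But the solution is defined at τ, so 𝒜G𝒜ᵀ is invertible
-- there as well, and the continuity of 𝒜G𝒜ᵀ then bounds its inverses nearby. This bounds y, S and
-- finally X S. Since Ẋ may be discontinuous, every estimate comes from a mean value inequality and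
-- none from integration. The system is nonlinear in X, but for one fixed v, with X and y regarded
-- as known, it is linear and homogeneous in u = Xv, so a zero of u propagates backwards in time.
-- Completeness enters through suprema alone: once in a real induction along the time interval, once
-- as the largest size of u on a short interval. Coercivity of a definite form is obtained by
-- symmetric elimination instead of compactness of a sphere.

module Analysis (ℝ : RealField) where

  open OverReals ℝ
  open CommutativeRing commutativeRing
    using ( refl; sym; trans; reflexive; +-cong; +-congˡ; +-congʳ; *-cong; *-congˡ; *-congʳ
          ; -‿cong; +-assoc; +-comm; +-identityˡ; +-identityʳ; -‿inverseʳ; -‿inverseˡ
          ; *-assoc; *-comm; *-identityˡ; zeroˡ; zeroʳ; ring; semiring; +-abelianGroup)
  open SemiringSum semiring
    using (∑-distrib-+; ∑-comm; sum-cong-≋; *-distribˡ-sum; *-distribʳ-sum)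

  -- The ring solver over ℤ.

  module IntegerCoefficients where
    open Multiples semiring renaming (_×_ to infixl 8 _·_)
    open AbelianGroupProperties +-abelianGroup using (⁻¹-∙-comm; ⁻¹-involutive; ε⁻¹≈ε)
    open RingProperties ring using (-‿distribˡ-*; -‿distribʳ-*)
    open SetoidReasoning setoid

    -- The optimised multiples make `⟦ + 0 ⟧` and `⟦ + 1 ⟧` reduce to `0#` and `1#`, so that
    -- `con (+ 0)` and `con (+ 1)` in a solver equation match the constants of a goal by
    -- computation.
    ⟦_⟧ : ℤ → Carrier
    ⟦ + n ⟧      = n · 1#
    ⟦ -[1+ n ] ⟧ = - (suc n · 1#)

    ⊖-homo : ∀ m n → ⟦ m ⊖ n ⟧ ≈ m · 1# - n · 1#
    ⊖-homo m zero = sym (trans (+-congˡ ε⁻¹≈ε) (+-identityʳ _))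
    ⊖-homo zero (suc n) = sym (+-identityˡ _)
    ⊖-homo (suc m) (suc n) rewrite ℤ.[1+m]⊖[1+n]≡m⊖n m n = begin
      ⟦ m ⊖ n ⟧                                ≈⟨ ⊖-homo m n ⟩
      m · 1# - n · 1#                          ≈⟨ +-congˡ (+-identityˡ _) ⟨
      m · 1# + (0# - n · 1#)                   ≈⟨ +-congˡ (+-congʳ (-‿inverseʳ 1#)) ⟨
      m · 1# + (1# - 1# - n · 1#)              ≈⟨ +-congˡ (+-assoc _ _ _) ⟩
      m · 1# + (1# + (- 1# - n · 1#))          ≈⟨ +-assoc _ _ _ ⟨
      m · 1# + 1# + (- 1# - n · 1#)            ≈⟨ +-cong (+-comm _ _) (⁻¹-∙-comm _ _) ⟩
      1# + m · 1# - (1# + n · 1#)              ≈⟨ +-cong (1+× m 1#) (-‿cong (1+× n 1#)) ⟨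
      suc m · 1# - suc n · 1#                  ∎

    +-homo : ∀ i j → ⟦ i ℤ.+ j ⟧ ≈ ⟦ i ⟧ + ⟦ j ⟧
    +-homo (+ m) (+ n) = ×-homo-+ 1# m n
    +-homo (+ m) -[1+ n ] = ⊖-homo m (suc n)
    +-homo -[1+ m ] (+ n) = trans (⊖-homo n (suc m)) (+-comm _ _)
    +-homo -[1+ m ] -[1+ n ] = begin
      - (suc (suc (m ℕ.+ n)) · 1#)        ≈⟨ -‿cong (×-congˡ (≡.cong suc (+-suc m n))) ⟨
      - ((suc m ℕ.+ suc n) · 1#)          ≈⟨ -‿cong (×-homo-+ 1# (suc m) (suc n)) ⟩
      - (suc m · 1# + suc n · 1#)         ≈⟨ ⁻¹-∙-comm _ _ ⟨
      - (suc m · 1#) - suc n · 1#         ∎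
      where
      ×-congˡ : ∀ {k l} → k ≡ l → k · 1# ≈ l · 1#
      ×-congˡ ≡.refl = refl

    -‿homo : ∀ i → ⟦ ℤ.- i ⟧ ≈ - ⟦ i ⟧
    -‿homo (+ zero)  = sym ε⁻¹≈ε
    -‿homo (+ suc n) = refl
    -‿homo -[1+ n ]  = sym (⁻¹-involutive _)

    +*-homo : ∀ m j → ⟦ + m ℤ.* j ⟧ ≈ m · 1# * ⟦ j ⟧
    +*-homo m (+ n) rewrite ≡.sym (ℤ.pos-* m n) = ×1-homo-* m n
    +*-homo m -[1+ n ] = begin
      ⟦ + m ℤ.* ℤ.- + suc n ⟧      ≡⟨ ≡.cong ⟦_⟧ (ℤ.neg-distribʳ-* (+ m) (+ suc n)) ⟨
      ⟦ ℤ.- (+ m ℤ.* + suc n) ⟧    ≈⟨ -‿homo (+ m ℤ.* + suc n) ⟩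
      - ⟦ + m ℤ.* + suc n ⟧        ≈⟨ -‿cong (+*-homo m (+ suc n)) ⟩
      - (m · 1# * (suc n · 1#))    ≈⟨ -‿distribʳ-* _ _ ⟩
      m · 1# * - (suc n · 1#)      ∎

    *-homo : ∀ i j → ⟦ i ℤ.* j ⟧ ≈ ⟦ i ⟧ * ⟦ j ⟧
    *-homo (+ m)    j = +*-homo m j
    *-homo -[1+ m ] j = begin
      ⟦ ℤ.- + suc m ℤ.* j ⟧        ≡⟨ ≡.cong ⟦_⟧ (ℤ.neg-distribˡ-* (+ suc m) j) ⟨
      ⟦ ℤ.- (+ suc m ℤ.* j) ⟧      ≈⟨ -‿homo (+ suc m ℤ.* j) ⟩
      - ⟦ + suc m ℤ.* j ⟧          ≈⟨ -‿cong (+*-homo (suc m) j) ⟩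
      - (suc m · 1# * ⟦ j ⟧)       ≈⟨ -‿distribˡ-* _ _ ⟩
      - (suc m · 1#) * ⟦ j ⟧       ∎

    morphism : ℤ.+-*-rawRing -Raw-AlmostCommutative⟶ fromCommutativeRing commutativeRing
    morphism = record
      { ⟦_⟧ = ⟦_⟧ ; +-homo = +-homo ; *-homo = *-homo ; -‿homo = -‿homo
      ; 0-homo = refl ; 1-homo = refl }

    -- The solver acts on positive answers only, so comparing the integers is enough and the
    -- injectivity of `⟦_⟧` does not come up.
    ≟-weak : ∀ i j → Maybe (⟦ i ⟧ ≈ ⟦ j ⟧)
    ≟-weak i j = Maybe.map (λ eq → reflexive (≡.cong ⟦_⟧ eq)) (dec⇒maybe (i ℤ.≟ j))

  open RingSolver ℤ.+-*-rawRing (fromCommutativeRing commutativeRing)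
    IntegerCoefficients.morphism IntegerCoefficients.≟-weak
    using (solve; _:=_; _:+_; _:*_; _:-_; :-_; con)

  -- Inequalities and absolute values in the ordered field.

  module OrderedField where

    open IsStrictTotalOrder isStrictTotalOrder public
      using () renaming (trans to <-trans; irrefl to <-irrefl; <-respʳ-≈ to <-respʳ; <-respˡ-≈ to <-respˡ)
    module ≤ = IsDecTotalOrder (NonStrict.isDecTotalOrder _≈_ _<_ isStrictTotalOrder)
    open ≤ public using (_≤?_)
      renaming (trans to ≤-trans; refl to ≤-refl; antisym to ≤-antisym; total to ≤-total)

    private variable a b c d x y z ε : Carrier

    <⇒≤ : x < y → x ≤ y
    <⇒≤ = inj₁

    ≈⇒≤ : x ≈ y → x ≤ y
    ≈⇒≤ = inj₂

    <-≤-trans : x < y → y ≤ z → x < z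
    <-≤-trans = NonStrict.<-≤-trans _≈_ _<_ <-trans <-respʳ

    ≤-<-trans : x ≤ y → y < z → x < z
    ≤-<-trans = NonStrict.≤-<-trans _≈_ _<_ sym <-trans <-respˡ

    ≤⇒≯ : x ≤ y → ¬ (y < x)
    ≤⇒≯ x≤y y<x = <-irrefl refl (≤-<-trans x≤y y<x)

    ≮⇒≥ : ¬ (x < y) → y ≤ x
    ≮⇒≥ {x} {y} x≮y with compare x y
    ... | tri< x<y _ _ = contradiction x<y x≮y
    ... | tri≈ _ x≈y _ = inj₂ (sym x≈y)
    ... | tri> _ _ y<x = inj₁ y<x

    ≰⇒> : ¬ (x ≤ y) → y < x
    ≰⇒> {x} {y} x≰y with compare x y
    ... | tri< x<y _ _ = contradiction (inj₁ x<y) x≰y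
    ... | tri≈ _ x≈y _ = contradiction (inj₂ x≈y) x≰y
    ... | tri> _ _ y<x = y<x

    ≤-resp : x ≈ a → y ≈ b → x ≤ y → a ≤ b
    ≤-resp x≈a y≈b x≤y = ≤-trans (≈⇒≤ (sym x≈a)) (≤-trans x≤y (≈⇒≤ y≈b))

    <-resp : x ≈ a → y ≈ b → x < y → a < b
    <-resp x≈a y≈b x<y = <-respʳ y≈b (<-respˡ x≈a x<y)

    -- Inequalities are proved by exhibiting the difference of the two sides as a
    -- combination of nonnegative terms and leaving the identity to the ring solver.
    ≤⇒0≤ : x ≤ y → 0# ≤ y - x
    ≤⇒0≤ {x} (inj₁ x<y) = inj₁ (<-respˡ (-‿inverseʳ x) (+-monoˡ-< (- x) x<y))
    ≤⇒0≤ {x} (inj₂ x≈y) = inj₂ (trans (sym (-‿inverseʳ x)) (+-congʳ x≈y))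

    <⇒0< : x < y → 0# < y - x
    <⇒0< {x} x<y = <-respˡ (-‿inverseʳ x) (+-monoˡ-< (- x) x<y)

    0<⇒< : 0# < z → z ≈ y - x → x < y
    0<⇒< {z} {y} {x} 0<z z≈ = <-resp (+-identityˡ x)
      (trans (+-congʳ z≈) (solve 2 (λ x y → y :- x :+ x := y) refl x y)) (+-monoˡ-< x 0<z)

    0≤⇒≤ : 0# ≤ z → z ≈ y - x → x ≤ y
    0≤⇒≤ (inj₁ 0<z) z≈ = inj₁ (0<⇒< 0<z z≈)
    0≤⇒≤ {z} {y} {x} (inj₂ 0≈z) z≈ = inj₂ (trans (sym (+-identityˡ x))
      (trans (+-congʳ (trans 0≈z z≈)) (solve 2 (λ x y → y :- x :+ x := y) refl x y)))

    0<+ : 0# < x → 0# < y → 0# < x + y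
    0<+ {x} {y} 0<x 0<y = <-trans 0<y (<-respˡ (+-identityˡ y) (+-monoˡ-< y 0<x))

    0<+≤ : 0# < x → 0# ≤ y → 0# < x + y
    0<+≤ 0<x (inj₁ 0<y) = 0<+ 0<x 0<y
    0<+≤ {x} 0<x (inj₂ 0≈y) = <-respʳ (trans (sym (+-identityʳ x)) (+-congˡ 0≈y)) 0<x

    0≤+ : 0# ≤ x → 0# ≤ y → 0# ≤ x + y
    0≤+ (inj₁ 0<x) 0≤y = inj₁ (0<+≤ 0<x 0≤y)
    0≤+ {x} {y} (inj₂ 0≈x) 0≤y = ≤-resp refl (trans (sym (+-identityˡ y)) (+-congʳ 0≈x)) 0≤y

    0≤* : 0# ≤ x → 0# ≤ y → 0# ≤ x * y
    0≤* (inj₁ 0<x) (inj₁ 0<y) = inj₁ (*-pos 0<x 0<y)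
    0≤* {x} {y} (inj₂ 0≈x) _ = inj₂ (trans (sym (zeroˡ y)) (*-congʳ 0≈x))
    0≤* {x} {y} (inj₁ _) (inj₂ 0≈y) = inj₂ (trans (sym (zeroʳ x)) (*-congˡ 0≈y))

    +-mono-≤ : a ≤ b → c ≤ d → a + c ≤ b + d
    +-mono-≤ {a} {b} {c} {d} a≤b c≤d = 0≤⇒≤ (0≤+ (≤⇒0≤ a≤b) (≤⇒0≤ c≤d))
      (solve 4 (λ a b c d → b :- a :+ (d :- c) := b :+ d :- (a :+ c)) refl a b c d)

    +-monoˡ-≤ : a ≤ b → a + c ≤ b + c
    +-monoˡ-≤ a≤b = +-mono-≤ a≤b ≤-refl

    +-monoʳ-≤ : c ≤ d → a + c ≤ a + d
    +-monoʳ-≤ c≤d = +-mono-≤ ≤-refl c≤d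

    *-monoʳ-≤ : 0# ≤ c → a ≤ b → c * a ≤ c * b
    *-monoʳ-≤ {c} {a} {b} 0≤c a≤b = 0≤⇒≤ (0≤* 0≤c (≤⇒0≤ a≤b))
      (solve 3 (λ a b c → c :* (b :- a) := c :* b :- c :* a) refl a b c)

    *-monoˡ-≤ : 0# ≤ c → a ≤ b → a * c ≤ b * c
    *-monoˡ-≤ 0≤c a≤b = ≤-resp (*-comm _ _) (*-comm _ _) (*-monoʳ-≤ 0≤c a≤b)

    *-mono-≤ : 0# ≤ a → 0# ≤ c → a ≤ b → c ≤ d → a * c ≤ b * d
    *-mono-≤ 0≤a 0≤c a≤b c≤d = ≤-trans (*-monoˡ-≤ 0≤c a≤b) (*-monoʳ-≤ (≤-trans 0≤a a≤b) c≤d)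

    neg-mono-≤ : a ≤ b → - b ≤ - a
    neg-mono-≤ {a} {b} a≤b = 0≤⇒≤ (≤⇒0≤ a≤b) (solve 2 (λ a b → b :- a := :- a :- :- b) refl a b)

    0≤x² : ∀ x → 0# ≤ x * x
    0≤x² x with ≤-total 0# x
    ... | inj₁ 0≤x = 0≤* 0≤x 0≤x
    ... | inj₂ x≤0 = ≤-resp refl (solve 1 (λ x → (con (+ 0) :- x) :* (con (+ 0) :- x) := x :* x) refl x)
                       (0≤* (≤⇒0≤ x≤0) (≤⇒0≤ x≤0))

    0<1 : 0# < 1#
    0<1 with compare 0# 1#
    ... | tri< 0<1 _ _ = 0<1
    ... | tri≈ _ 0≈1 _ = contradiction (sym 0≈1) 1≉0
    ... | tri> _ _ 1<0 = nonzero (0≤x² 1#)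
      where
      nonzero : 0# ≤ 1# * 1# → 0# < 1#
      nonzero (inj₁ p) = <-respʳ (*-identityˡ 1#) p
      nonzero (inj₂ p) = contradiction (trans (sym (*-identityˡ 1#)) (sym p)) 1≉0

    0<⇒≉0 : 0# < x → ¬ (x ≈ 0#)
    0<⇒≉0 0<x x≈0 = <-irrefl (sym x≈0) 0<x

    0<-cancelˡ : 0# ≤ x → 0# < x * y → 0# < y
    0<-cancelˡ {x} {y} 0≤x 0<xy with compare 0# y
    ... | tri< 0<y _ _ = 0<y
    ... | tri≈ _ 0≈y _ = contradiction (trans (*-congˡ (sym 0≈y)) (zeroʳ x)) (0<⇒≉0 0<xy)
    ... | tri> _ _ y<0 = contradiction 0<xy (≤⇒≯ (0≤⇒≤ (0≤* 0≤x (≤⇒0≤ (<⇒≤ y<0)))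
            (solve 2 (λ x y → x :* (con (+ 0) :- y) := con (+ 0) :- x :* y) refl x y)))

    reciprocal : 0# < x → ∃[ y ] 0# < y × x * y ≈ 1#
    reciprocal {x} 0<x with inverse x (0<⇒≉0 0<x)
    ... | r , xr≈1 = r , 0<-cancelˡ (<⇒≤ 0<x) (<-respʳ (sym xr≈1) 0<1) , xr≈1

    0≤-cancelˡ : 0# < x → 0# ≤ x * y → 0# ≤ y
    0≤-cancelˡ {x} {y} 0<x 0≤xy with reciprocal 0<x
    ... | r , 0<r , xr≈1 = ≤-resp refl
      (trans (solve 3 (λ x y r → r :* (x :* y) := x :* r :* y) refl x y r)
        (trans (*-congʳ xr≈1) (*-identityˡ y)))
      (0≤* (<⇒≤ 0<r) 0≤xy)

    halve : ∀ ε → 0# < ε → ∃[ h ] 0# < h × h + h ≈ ε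
    halve ε 0<ε with reciprocal (0<+ 0<1 0<1)
    ... | r , 0<r , 2r≈1 = r * ε , *-pos 0<r 0<ε ,
      trans (solve 2 (λ r ε → r :* ε :+ r :* ε := (con (+ 1) :+ con (+ 1)) :* r :* ε) refl r ε)
        (trans (*-congʳ 2r≈1) (*-identityˡ ε))

    -- The quotient of ε by a nonnegative B, which may be zero, is replaced by a
    -- positive δ with δ * B ≤ ε.
    shrink : ∀ B → 0# ≤ B → 0# < ε → ∃[ δ ] 0# < δ × δ * B ≤ ε
    shrink {ε} B 0≤B 0<ε with reciprocal (0<+≤ 0<1 0≤B)
    ... | r , 0<r , sr≈1 = r * ε , *-pos 0<r 0<ε , 0≤⇒≤ (<⇒≤ (*-pos 0<r 0<ε))
      (trans (solve 3 (λ r ε B → r :* ε := (con (+ 1) :+ B) :* r :* ε :- r :* ε :* B) refl r ε B)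
        (+-congʳ (trans (*-congʳ sr≈1) (*-identityˡ ε))))

    -- If y < x, half of the gap x - y is an ε that violates the hypothesis.
    ≤-ε : (∀ ε → 0# < ε → x ≤ y + ε) → x ≤ y
    ≤-ε {x} {y} h with x ≤? y
    ... | yes x≤y = x≤y
    ... | no x≰y with halve (x - y) (<⇒0< (≰⇒> x≰y))
    ...   | e , 0<e , 2e≈ = contradiction (h e 0<e) λ x≤y+e → ≤⇒≯ x≤y+e (0<⇒< 0<e
            (trans (solve 3 (λ e x y → e := (e :+ e) :- (x :- y) :+ (x :- (y :+ e))) refl e x y)
              (trans (+-congʳ (trans (+-congʳ 2e≈) (-‿inverseʳ _))) (+-identityˡ _))))

    minimum : ∀ x y → ∃[ z ] z ≤ x × z ≤ y × (0# < x → 0# < y → 0# < z)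
    minimum x y with ≤-total x y
    ... | inj₁ x≤y = x , ≤-refl , x≤y , λ p _ → p
    ... | inj₂ y≤x = y , y≤x , ≤-refl , λ _ p → p

    ∣x∣-cases : ∀ x → (x < 0# × ∣ x ∣ ≈ - x) ⊎ (0# ≤ x × ∣ x ∣ ≈ x)
    ∣x∣-cases x with x <? 0#
    ... | yes x<0 = inj₁ (x<0 , refl)
    ... | no x≮0 = inj₂ (≮⇒≥ x≮0 , refl)

    ∣x∣≤ : x ≤ b → - x ≤ b → ∣ x ∣ ≤ b
    ∣x∣≤ {x} x≤b -x≤b with ∣x∣-cases x
    ... | inj₁ (_ , e) = ≤-resp (sym e) refl -x≤b
    ... | inj₂ (_ , e) = ≤-resp (sym e) refl x≤b

    0≤∣x∣ : ∀ x → 0# ≤ ∣ x ∣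
    0≤∣x∣ x with ∣x∣-cases x
    ... | inj₁ (x<0 , e) = 0≤⇒≤ (≤⇒0≤ (<⇒≤ x<0))
            (trans (solve 1 (λ x → con (+ 0) :- x := :- x :- con (+ 0)) refl x) (+-congʳ (sym e)))
    ... | inj₂ (0≤x , e) = ≤-resp refl (sym e) 0≤x

    x≤∣x∣ : ∀ x → x ≤ ∣ x ∣
    x≤∣x∣ x with ∣x∣-cases x
    ... | inj₁ (x<0 , e) = ≤-trans (<⇒≤ x<0) (0≤∣x∣ x)
    ... | inj₂ (_ , e) = ≈⇒≤ (sym e)

    -x≤∣x∣ : ∀ x → - x ≤ ∣ x ∣
    -x≤∣x∣ x with ∣x∣-cases x
    ... | inj₁ (_ , e) = ≈⇒≤ (sym e)
    ... | inj₂ (0≤x , e) = ≤-trans (0≤⇒≤ 0≤x (solve 1 (λ x → x := con (+ 0) :- :- x) refl x)) (0≤∣x∣ x)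

    -- `∣_∣` branches on a decision about its argument, which setoid-equal arguments need not share
    -- by computation. Antisymmetry applied to the bounds that characterise `∣_∣` avoids comparing
    -- the branches.
    ∣∣-cong : x ≈ y → ∣ x ∣ ≈ ∣ y ∣
    ∣∣-cong {x} {y} x≈y = ≤-antisym (h x≈y) (h (sym x≈y))
      where
      h : ∀ {x y} → x ≈ y → ∣ x ∣ ≤ ∣ y ∣
      h {x} {y} x≈y = ∣x∣≤ (≤-resp (sym x≈y) refl (x≤∣x∣ y)) (≤-resp (-‿cong (sym x≈y)) refl (-x≤∣x∣ y))

    0≤⇒∣x∣≈x : 0# ≤ x → ∣ x ∣ ≈ x
    0≤⇒∣x∣≈x {x} 0≤x = ≤-antisym
      (∣x∣≤ ≤-refl (0≤⇒≤ (0≤+ 0≤x 0≤x) (solve 1 (λ x → x :+ x := x :- :- x) refl x)))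
      (x≤∣x∣ x)

    ∣-x∣≤∣x∣ : ∀ x → ∣ - x ∣ ≤ ∣ x ∣
    ∣-x∣≤∣x∣ x = ∣x∣≤ (-x≤∣x∣ x) (≤-resp (solve 1 (λ x → x := :- :- x) refl x) refl (x≤∣x∣ x))

    ∣-x∣≈∣x∣ : ∀ x → ∣ - x ∣ ≈ ∣ x ∣
    ∣-x∣≈∣x∣ x = ≤-antisym (∣-x∣≤∣x∣ x)
      (≤-trans (≈⇒≤ (∣∣-cong (solve 1 (λ x → x := :- :- x) refl x))) (∣-x∣≤∣x∣ (- x)))

    ∣x+y∣≤ : ∀ x y → ∣ x + y ∣ ≤ ∣ x ∣ + ∣ y ∣
    ∣x+y∣≤ x y = ∣x∣≤ (+-mono-≤ (x≤∣x∣ x) (x≤∣x∣ y))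
      (≤-resp (solve 2 (λ x y → :- x :+ :- y := :- (x :+ y)) refl x y) refl (+-mono-≤ (-x≤∣x∣ x) (-x≤∣x∣ y)))

    ∣xy∣≤ : ∀ x y → ∣ x * y ∣ ≤ ∣ x ∣ * ∣ y ∣
    ∣xy∣≤ x y with ∣x∣-cases x
    ... | inj₁ (x<0 , e) = ∣x∣≤
            (≤-resp (solve 2 (λ x y → :- x :* :- y := x :* y) refl x y)
              (*-congʳ (sym e)) (*-monoʳ-≤ 0≤-x (-x≤∣x∣ y)))
            (≤-resp (solve 2 (λ x y → :- x :* y := :- (x :* y)) refl x y)
              (*-congʳ (sym e)) (*-monoʳ-≤ 0≤-x (x≤∣x∣ y)))
      where
      0≤-x : 0# ≤ - x
      0≤-x = ≤-resp refl (+-identityˡ _) (≤⇒0≤ (<⇒≤ x<0))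
    ... | inj₂ (0≤x , e) = ∣x∣≤
            (≤-resp refl (*-congʳ (sym e)) (*-monoʳ-≤ 0≤x (x≤∣x∣ y)))
            (≤-resp (solve 2 (λ x y → x :* :- y := :- (x :* y)) refl x y)
              (*-congʳ (sym e)) (*-monoʳ-≤ 0≤x (-x≤∣x∣ y)))

    ∣x∣≤0⇒x≈0 : ∣ x ∣ ≤ 0# → x ≈ 0#
    ∣x∣≤0⇒x≈0 {x} ∣x∣≤0 = ≤-antisym (≤-trans (x≤∣x∣ x) ∣x∣≤0)
      (0≤⇒≤ (≤⇒0≤ (≤-trans (-x≤∣x∣ x) ∣x∣≤0)) (solve 1 (λ x → con (+ 0) :- :- x := x :- con (+ 0)) refl x))

    x-y≈0⇒x≈y : x - y ≈ 0# → x ≈ y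
    x-y≈0⇒x≈y {x} {y} x-y≈0 = trans (solve 2 (λ x y → x := (x :- y) :+ y) refl x y)
      (trans (+-congʳ x-y≈0) (+-identityˡ y))

    smaller : ∀ ε → 0# < ε → ∃[ h ] 0# < h × h < ε
    smaller ε 0<ε = let h , 0<h , h+h≈ε = halve ε 0<ε in
      h , 0<h , 0<⇒< 0<h (trans (solve 1 (λ h → h := h :+ h :- h) refl h) (+-congʳ h+h≈ε))

    ∣x-y∣≈∣y-x∣ : ∀ x y → ∣ x - y ∣ ≈ ∣ y - x ∣
    ∣x-y∣≈∣y-x∣ x y = trans (sym (∣-x∣≈∣x∣ (x - y))) (∣∣-cong (swap x y))
      where
      swap : ∀ x y → - (x - y) ≈ y - x
      swap = solve 2 (λ x y → :- (x :- y) := y :- x) refl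

  open OrderedField

  -- Finite sums, matrix-vector products, norms, and the Kronecker product.

  module LinearAlgebra where

    private variable
      m n p : ℕ

    sum-cong : {f g : Vector Carrier n} → f ≋ g → sum f ≈ sum g
    sum-cong = sum-cong-≋

    sum-zero : {f : Vector Carrier n} → f ≋ 0ᵥ → sum f ≈ 0#
    sum-zero {zero}  f≋0 = refl
    sum-zero {suc n} f≋0 = trans (+-cong (f≋0 zero) (sum-zero (f≋0 ∘ suc))) (+-identityˡ 0#)

    sum-mono : {f g : Vector Carrier n} → (∀ i → f i ≤ g i) → sum f ≤ sum g
    sum-mono {zero}  f≤g = ≤-refl
    sum-mono {suc n} f≤g = +-mono-≤ (f≤g zero) (sum-mono (f≤g ∘ suc))

    0≤sum : {f : Vector Carrier n} → (∀ i → 0# ≤ f i) → 0# ≤ sum f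
    0≤sum {zero}  0≤f = ≤-refl
    0≤sum {suc n} 0≤f = 0≤+ (0≤f zero) (0≤sum (0≤f ∘ suc))

    term≤sum : {f : Vector Carrier n} → (∀ i → 0# ≤ f i) → ∀ i → f i ≤ sum f
    term≤sum {f = f} 0≤f zero = ≤-resp (+-identityʳ (f zero)) refl (+-monoʳ-≤ (0≤sum (0≤f ∘ suc)))
    term≤sum 0≤f (suc i) = ≤-resp (+-identityˡ _) refl (+-mono-≤ (0≤f zero) (term≤sum (0≤f ∘ suc) i))

    ∣sum∣≤ : (f : Vector Carrier n) → ∣ sum f ∣ ≤ sum (λ i → ∣ f i ∣)
    ∣sum∣≤ {zero}  f = ≈⇒≤ (0≤⇒∣x∣≈x ≤-refl)
    ∣sum∣≤ {suc n} f = ≤-trans (∣x+y∣≤ _ _) (+-monoʳ-≤ (∣sum∣≤ (f ∘ suc)))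

    -‿distrib-sum : (f : Vector Carrier n) → - sum f ≈ sum (λ i → - f i)
    -‿distrib-sum {zero}  f = solve 0 (:- con (+ 0) := con (+ 0)) refl
    -‿distrib-sum {suc n} f = trans (solve 2 (λ x y → :- (x :+ y) := :- x :+ :- y) refl _ _)
      (+-congˡ (-‿distrib-sum (f ∘ suc)))

    sum-∸ : (f g : Vector Carrier n) → sum (λ i → f i - g i) ≈ sum f - sum g
    sum-∸ f g = trans (∑-distrib-+ f (λ i → - g i)) (+-congˡ (sym (-‿distrib-sum g)))

    sum-++ : ∀ m {n} (f : Vector Carrier (m ℕ.+ n)) →
             sum f ≈ sum (λ i → f (i ↑ˡ n)) + sum (λ j → f (m ↑ʳ j))
    sum-++ zero    f = sym (+-identityˡ _)
    sum-++ (suc m) f = trans (+-congˡ (sum-++ m (f ∘ suc))) (sym (+-assoc _ _ _))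

    sum-combine : ∀ m {n} (f : Vector Carrier (m ℕ.* n)) →
                  sum f ≈ sum (λ i → sum (λ j → f (combine {m} i j)))
    sum-combine zero    f = refl
    sum-combine (suc m) {n} f = trans (sum-++ n f) (+-congˡ (sum-combine m (λ k → f (n ↑ʳ k))))

    sum-Id : (i : Fin n) (v : Vector Carrier n) → sum (λ j → Id i j * v j) ≈ v i
    sum-Id {suc n} zero v = trans (+-cong (*-identityˡ _) (sum-zero λ j → zeroˡ (v (suc j)))) (+-identityʳ _)
    -- `does (suc i ≟ suc j)` reduces to `does (i ≟ j)`, so the tail is the same sum for `i`.
    sum-Id {suc n} (suc i) v = trans (+-cong (zeroˡ _) (sum-Id i (v ∘ suc))) (+-identityˡ _)

    ∙-comm : (u v : Vector Carrier n) → u ∙ v ≈ v ∙ u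
    ∙-comm u v = sum-cong λ i → *-comm (u i) (v i)

    ∙-cong : {u u′ v v′ : Vector Carrier n} → u ≋ u′ → v ≋ v′ → u ∙ v ≈ u′ ∙ v′
    ∙-cong u≋ v≋ = sum-cong λ i → *-cong (u≋ i) (v≋ i)

    ∙-zeroʳ : (u : Vector Carrier n) {v : Vector Carrier n} → v ≋ 0ᵥ → u ∙ v ≈ 0#
    ∙-zeroʳ u v≋0 = sum-zero λ i → trans (*-congˡ (v≋0 i)) (zeroʳ (u i))

    ∙-+ʳ : (u v w : Vector Carrier n) → u ∙ (λ i → v i + w i) ≈ u ∙ v + u ∙ w
    ∙-+ʳ u v w = trans (sum-cong λ i → 
        solve 3 (λ u v w → u :* (v :+ w) := u :* v :+ u :* w) refl (u i) (v i) (w i))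
      (∑-distrib-+ (λ i → u i * v i) (λ i → u i * w i))

    ∙-∸ʳ : (u v w : Vector Carrier n) → u ∙ (λ i → v i - w i) ≈ u ∙ v - u ∙ w
    ∙-∸ʳ u v w = trans (sum-cong λ i → 
        solve 3 (λ u v w → u :* (v :- w) := u :* v :- u :* w) refl (u i) (v i) (w i))
      (sum-∸ (λ i → u i * v i) (λ i → u i * w i))

    ∙-*ʳ : (u v : Vector Carrier n) (c : Carrier) → u ∙ (λ i → c * v i) ≈ c * (u ∙ v)
    ∙-*ʳ u v c = trans (sum-cong λ i → solve 3 (λ u v c → u :* (c :* v) := c :* (u :* v)) refl (u i) (v i) c)
      (sym (*-distribˡ-sum c (λ i → u i * v i)))

    -- The interchange of two summations. Taking for `u` a row of a matrix gives `*ᵥ-assoc`; a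
    -- symmetric `M` gives self-adjointness.
    ∙-assoc : (u : Vector Carrier m) (M : Matrix m n) (v : Vector Carrier n) →
              u ∙ (M *ᵥ v) ≈ (λ j → sum (λ i → u i * M i j)) ∙ v
    ∙-assoc {m = m} {n = n} u M v = begin
      sum (λ i → u i * sum (λ j → M i j * v j))
        ≈⟨ sum-cong (λ i → *-distribˡ-sum (u i) (λ j → M i j * v j)) ⟩
      sum (λ i → sum (λ j → u i * (M i j * v j)))
        ≈⟨ ∑-comm (λ i j → u i * (M i j * v j)) ⟩
      sum (λ j → sum (λ i → u i * (M i j * v j)))
        ≈⟨ sum-cong (λ j → sum-cong λ i → *-assoc (u i) (M i j) (v j)) ⟨
      sum (λ j → sum (λ i → u i * M i j * v j))
        ≈⟨ sum-cong (λ j → *-distribʳ-sum (v j) (λ i → u i * M i j)) ⟨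
      sum (λ j → sum (λ i → u i * M i j) * v j)  ∎
      where open SetoidReasoning setoid

    *ᵥ-assoc : (M : Matrix m n) (N : Matrix n p) (v : Vector Carrier p) →
               (M *ₘ N) *ᵥ v ≋ M *ᵥ (N *ᵥ v)
    *ᵥ-assoc M N v i = sym (∙-assoc (M i) N v)

    ∙-symmetric : {M : Matrix n n} → IsSymmetric M → (u v : Vector Carrier n) →
                  u ∙ (M *ᵥ v) ≈ v ∙ (M *ᵥ u)
    ∙-symmetric {M = M} symM u v = trans (∙-assoc u M v)
      (trans (∙-comm _ v) (∙-cong {u = v} (λ _ → refl) λ j → sum-cong λ i →
        trans (*-comm _ _) (*-congʳ (symM j i))))

    Id-*ᵥ : (v : Vector Carrier n) → Id *ᵥ v ≋ v
    Id-*ᵥ v i = sum-Id i v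

    *ᵥ-congˡ : (M : Matrix m n) {u v : Vector Carrier n} → u ≋ v → M *ᵥ u ≋ M *ᵥ v
    *ᵥ-congˡ M u≋v i = ∙-cong {u = M i} (λ _ → refl) u≋v

    *ᵥ-congʳ : {M N : Matrix m n} (v : Vector Carrier n) → M ≈ₘ N → M *ᵥ v ≋ N *ᵥ v
    *ᵥ-congʳ v M≈N i = ∙-cong {v = v} (M≈N i) (λ _ → refl)

    -ₘ-*ᵥ : (M N : Matrix m n) (v : Vector Carrier n) → (M -ₘ N) *ᵥ v ≋ (λ i → (M *ᵥ v) i - (N *ᵥ v) i)
    -ₘ-*ᵥ M N v i = trans (∙-comm (λ j → M i j - N i j) v)
      (trans (∙-∸ʳ v (M i) (N i)) (+-cong (∙-comm v (M i)) (-‿cong (∙-comm v (N i)))))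

    -- The ℓ¹ norm, which involves neither square roots nor maxima. The entrywise ℓ¹ norm of a
    -- matrix, defined next, dominates the corresponding operator norm.
    ∥_∥ : Vector Carrier n → Carrier
    ∥ v ∥ = sum (λ i → ∣ v i ∣)

    ∥_∥ₘ : Matrix m n → Carrier
    ∥ M ∥ₘ = sum (λ i → ∥ M i ∥)

    0≤∥_∥ : (v : Vector Carrier n) → 0# ≤ ∥ v ∥
    0≤∥ v ∥ = 0≤sum λ i → 0≤∣x∣ (v i)

    0≤∥_∥ₘ : (M : Matrix m n) → 0# ≤ ∥ M ∥ₘ
    0≤∥ M ∥ₘ = 0≤sum λ i → 0≤∥ M i ∥

    ∣vᵢ∣≤∥v∥ : (v : Vector Carrier n) (i : Fin n) → ∣ v i ∣ ≤ ∥ v ∥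
    ∣vᵢ∣≤∥v∥ v = term≤sum λ i → 0≤∣x∣ (v i)

    ∣∙∣≤ : (u v : Vector Carrier n) → ∣ u ∙ v ∣ ≤ ∥ u ∥ * ∥ v ∥
    ∣∙∣≤ u v = ≤-trans (∣sum∣≤ (λ i → u i * v i)) (≤-trans
      (sum-mono λ i → ≤-trans (∣xy∣≤ (u i) (v i)) (*-monoʳ-≤ (0≤∣x∣ (u i)) (∣vᵢ∣≤∥v∥ v i)))
      (≈⇒≤ (sym (*-distribʳ-sum ∥ v ∥ (λ i → ∣ u i ∣)))))

    ∥*ᵥ∥≤ : (M : Matrix m n) (v : Vector Carrier n) → ∥ M *ᵥ v ∥ ≤ ∥ M ∥ₘ * ∥ v ∥
    ∥*ᵥ∥≤ M v = ≤-trans (sum-mono λ i → ∣∙∣≤ (M i) v) (≈⇒≤ (sym (*-distribʳ-sum ∥ v ∥ (λ i → ∥ M i ∥))))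

    ∥∥-cong : {u v : Vector Carrier n} → u ≋ v → ∥ u ∥ ≈ ∥ v ∥
    ∥∥-cong u≋v = sum-cong λ i → ∣∣-cong (u≋v i)

    ∥+∥≤ : (u v : Vector Carrier n) → ∥ (λ i → u i + v i) ∥ ≤ ∥ u ∥ + ∥ v ∥
    ∥+∥≤ u v = ≤-trans (sum-mono λ i → ∣x+y∣≤ (u i) (v i))
      (≈⇒≤ (∑-distrib-+ (λ i → ∣ u i ∣) (λ i → ∣ v i ∣)))

    ∙-negʳ : (u v : Vector Carrier n) → u ∙ (-ᵥ v) ≈ - (u ∙ v)
    ∙-negʳ u v = trans (sum-cong λ i → solve 2 (λ u v → u :* :- v := :- (u :* v)) refl (u i) (v i))
      (sym (-‿distrib-sum (λ i → u i * v i)))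

    ∥v∥≤0⇒v≋0 : (v : Vector Carrier n) → ∥ v ∥ ≤ 0# → v ≋ 0ᵥ
    ∥v∥≤0⇒v≋0 v ∥v∥≤0 i = ∣x∣≤0⇒x≈0 (≤-trans (∣vᵢ∣≤∥v∥ v i) ∥v∥≤0)

    vec-combine : (M : Matrix n n) (i j : Fin n) → vec M (combine j i) ≡.≡ M i j
    vec-combine M i j = ≡.cong (λ qr → M (proj₂ qr) (proj₁ qr)) (remQuot-combine j i)

    -- This is (M ⊗ N) vec(V) = vec(N V Mᵀ), read at the entry (i , j): for v = vec(V) the number
    -- `v (combine p q)` is `V q p`.
    ⊗-combine : (M N : Matrix n n) (v : Vector Carrier (n ℕ.* n)) (i j : Fin n) →
      ((M ⊗ N) *ᵥ v) (combine j i) ≈ M j ∙ (λ p → N i ∙ (λ q → v (combine p q)))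
    ⊗-combine {n} M N v i j = begin
      ((M ⊗ N) *ᵥ v) (combine j i)
        ≡⟨ ≡.cong (λ qr → sum (λ s → M (proj₁ qr) (quotient n s) * N (proj₂ qr) (remainder {n} n s) * v s))
             (remQuot-combine j i) ⟩
      sum (λ s → M j (quotient n s) * N i (remainder {n} n s) * v s)
        ≈⟨ sum-combine n (λ s → M j (quotient n s) * N i (remainder {n} n s) * v s) ⟩
      sum {n} (λ p → sum {n} (λ q →
          M j (quotient n (combine p q)) * N i (remainder {n} n (combine p q)) * v (combine p q)))
        ≈⟨ sum-cong {n} (λ p → sum-cong {n} λ q → reflexive
             (≡.cong (λ qr → M j (proj₁ qr) * N i (proj₂ qr) * v (combine p q)) (remQuot-combine p q))) ⟩
      sum (λ p → sum (λ q → M j p * N i q * v (combine p q)))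
        ≈⟨ sum-cong (λ p → trans (sum-cong λ q → *-assoc (M j p) (N i q) (v (combine p q)))
             (sym (*-distribˡ-sum (M j p) (λ q → N i q * v (combine p q))))) ⟩
      M j ∙ (λ p → N i ∙ (λ q → v (combine p q))) ∎
      where open SetoidReasoning setoid

  open LinearAlgebra

  -- Real induction, derivatives, the mean value inequality, and uniqueness backwards in time.

  module Calculus where

    private variable
      a b : Carrier
      n : ℕ

    -- The witness is the larger of a and b - δ/2.
    approach-from-below : ∀ {δ} → a < b → 0# < δ → ∃[ s ] a ≤ s × s < b × b - s < δ
    approach-from-below {a} {b} {δ} a<b 0<δ =
      let h , 0<h , h+h≈δ = halve δ 0<δ in from h 0<h h+h≈δ (≤-total a (b - h))
      where
      from : ∀ h → 0# < h → h + h ≈ δ → a ≤ b - h ⊎ b - h ≤ a → ∃[ s ] a ≤ s × s < b × b - s < δ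
      from h 0<h h+h≈δ (inj₁ a≤b-h) = 
        b - h , a≤b-h , 0<⇒< 0<h (solve 2 (λ b h → h := b :- (b :- h)) refl b h) ,
        0<⇒< 0<h (trans (solve 2 (λ b h → h := h :+ h :- (b :- (b :- h))) refl b h) (+-congʳ h+h≈δ))
      from h 0<h h+h≈δ (inj₂ b-h≤a) = a , ≤-refl , a<b ,
        0<⇒< (0<+≤ 0<h (≤⇒0≤ b-h≤a))
          (trans (solve 3 (λ a b h → h :+ (a :- (b :- h)) := h :+ h :- (b :- a)) refl a b h) (+-congʳ h+h≈δ))

    -- Let τ be the supremum of the points up to which `P` holds throughout. `closed` gives `P` at
    -- τ, and if τ < b then `open′` would reach beyond it. The base case is `closed` at a, where the
    -- condition on earlier points is vacuous. A supremum yields a reached point beyond r < τ only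
    -- up to double negation, hence the stability of `P`.
    realInduction : (P : Carrier → Set) → (∀ s → ¬ ¬ P s → P s) → a ≤ b →
      (∀ τ → a ≤ τ → τ ≤ b → (∀ s → a ≤ s → s < τ → P s) → P τ) →
      (∀ τ → a ≤ τ → τ < b → P τ → ∃[ δ ] 0# < δ × (∀ s → τ < s → s ≤ b → s - τ < δ → P s)) →
      ∀ s → a ≤ s → s ≤ b → P s
    realInduction {a} {b} P stable a≤b closed open′ s a≤s s≤b =
      closed s a≤s s≤b λ r a≤r r<s → below r a≤r (<-≤-trans r<s (≤-trans s≤b b≤τ))
      where
      Reached : Carrier → Set
      Reached x = a ≤ x × x ≤ b × (∀ r → a ≤ r → r ≤ x → P r)

      reached-a : Reached a
      reached-a = ≤-refl , a≤b , λ r a≤r r≤a → closed r a≤r (≤-trans r≤a a≤b)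
        λ s a≤s s<r → contradiction (<-≤-trans s<r r≤a) (≤⇒≯ a≤s)

      sup = supremum Reached (a , reached-a) (b , λ x (_ , x≤b , _) → x≤b)
      τ = proj₁ sup
      τ-upper : IsUpperBound Reached τ
      τ-upper = proj₁ (proj₂ sup)
      τ-least : ∀ c → IsUpperBound Reached c → τ ≤ c
      τ-least = proj₂ (proj₂ sup)

      a≤τ : a ≤ τ
      a≤τ = τ-upper a reached-a

      τ≤b : τ ≤ b
      τ≤b = τ-least b λ x (_ , x≤b , _) → x≤b

      below : ∀ r → a ≤ r → r < τ → P r
      -- If `P r` failed, no reached point could exceed r, making r an upper bound below the
      -- supremum.
      below r a≤r r<τ = stable r λ ¬Pr → ≤⇒≯ (τ-least r λ x (_ , _ , Px) → bound ¬Pr Px) r<τ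
        where
        bound : ¬ P r → ∀ {x} → (∀ r → a ≤ r → r ≤ x → P r) → x ≤ r
        bound ¬Pr {x} Px with x ≤? r
        ... | yes x≤r = x≤r
        ... | no x≰r = contradiction (Px r a≤r (<⇒≤ (≰⇒> x≰r))) ¬Pr

      Pτ : P τ
      Pτ = closed τ a≤τ τ≤b below

      beyond : ∀ e → 0# < e → e ≤ b - τ → ∀ {δ} → e < δ →
        ¬ (∀ s → τ < s → s ≤ b → s - τ < δ → P s)
      beyond e 0<e e≤b-τ {δ} e<δ ahead =
        ≤⇒≯ (τ-upper (τ + e) (≤-trans a≤τ (<⇒≤ τ<τ+e) , τ+e≤b , reached)) τ<τ+e
        where
        τ<τ+e : τ < τ + e
        τ<τ+e = 0<⇒< 0<e (solve 2 (λ t e → e := t :+ e :- t) refl τ e)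
        τ+e≤b : τ + e ≤ b
        τ+e≤b = 0≤⇒≤ (≤⇒0≤ e≤b-τ) (solve 3 (λ t e b → b :- t :- e := b :- (t :+ e)) refl τ e b)
        close : ∀ r → r ≤ τ + e → r - τ < δ
        close r r≤τ+e = ≤-<-trans
          (0≤⇒≤ (≤⇒0≤ r≤τ+e) (solve 3 (λ r t e → t :+ e :- r := e :- (r :- t)) refl r τ e))
          e<δ
        reached : ∀ r → a ≤ r → r ≤ τ + e → P r
        reached r a≤r r≤τ+e = by-cases (compare r τ)
          where
          by-cases : Tri (r < τ) (r ≈ τ) (τ < r) → P r
          by-cases (tri< r<τ _ _) = below r a≤r r<τ
          -- `P` is not assumed to respect `_≈_`, so the point r is closed off afresh instead of
          -- transporting `Pτ`.
          by-cases (tri≈ _ r≈τ _) = closed r a≤r (≤-trans (≈⇒≤ r≈τ) τ≤b) λ s a≤s s<r →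
            below s a≤s (<-respʳ r≈τ s<r)
          by-cases (tri> _ _ τ<r) = ahead r τ<r (≤-trans r≤τ+e τ+e≤b) (close r r≤τ+e)

      b≤τ : b ≤ τ
      b≤τ = decidable-stable (b ≤? τ) λ b≰τ →
        let δ , 0<δ , ahead = open′ τ a≤τ (≰⇒> b≰τ) Pτ
            h , 0<h , h<δ = smaller δ 0<δ
            -- The step e stays strictly inside the radius δ and keeps τ + e within the interval.
            e , e≤h , e≤b-τ , 0<e = minimum h (b - τ)
        in beyond e (0<e 0<h (<⇒0< (≰⇒> b≰τ))) e≤b-τ (≤-<-trans e≤h h<δ) ahead

    module _ {J : Carrier → Set} where

      derivative-0 : ∀ t → HasDerivativeWithin J (λ _ → 0#) t 0#
      derivative-0 t ε 0<ε = 1# , 0<1 , λ s _ _ →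
        ≤-trans (≈⇒≤ (trans (∣∣-cong (vanish (s - t))) (0≤⇒∣x∣≈x ≤-refl))) (0≤* (<⇒≤ 0<ε) (0≤∣x∣ (s - t)))
        where
        vanish : ∀ h → 0# - 0# - 0# * h ≈ 0#
        vanish = solve 1 (λ h → con (+ 0) :- con (+ 0) :- con (+ 0) :* h := con (+ 0)) refl

      derivative-+ : ∀ {f g t f′ g′} → HasDerivativeWithin J f t f′ → HasDerivativeWithin J g t g′ →
        HasDerivativeWithin J (λ s → f s + g s) t (f′ + g′)
      derivative-+ {f} {g} {t} {f′} {g′} Df Dg ε 0<ε =
        let h , 0<h , h+h≈ε = halve ε 0<ε
            δ₁ , 0<δ₁ , b₁ = Df h 0<h
            δ₂ , 0<δ₂ , b₂ = Dg h 0<h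
            δ , δ≤δ₁ , δ≤δ₂ , 0<δ = minimum δ₁ δ₂
        in δ , 0<δ 0<δ₁ 0<δ₂ , λ s js near → ≤-trans (≈⇒≤ (∣∣-cong (split s)))
          (≤-trans (∣x+y∣≤ _ _)
          (≤-trans (+-mono-≤ (b₁ s js (<-≤-trans near δ≤δ₁)) (b₂ s js (<-≤-trans near δ≤δ₂)))
            (≈⇒≤ (trans (regroup h ∣ s - t ∣) (*-congʳ h+h≈ε)))))
        where
        split : ∀ s → f s + g s - (f t + g t) - (f′ + g′) * (s - t) ≈
                      (f s - f t - f′ * (s - t)) + (g s - g t - g′ * (s - t))
        split s = trans
          (+-congʳ (solve 4 (λ a b d e → a :+ d :- (b :+ e) := a :- b :+ (d :- e)) refl (f s) (f t) (g s) (g t)))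
          (solve 5 (λ x y c k h → x :+ y :- (c :+ k) :* h := (x :- c :* h) :+ (y :- k :* h))
            refl (f s - f t) (g s - g t) f′ g′ (s - t))
        regroup : ∀ h x → h * x + h * x ≈ (h + h) * x
        regroup = solve 2 (λ h x → h :* x :+ h :* x := (h :+ h) :* x) refl

      derivative-* : ∀ c {f t f′} → HasDerivativeWithin J f t f′ →
        HasDerivativeWithin J (λ s → c * f s) t (c * f′)
      derivative-* c {f} {t} {f′} Df ε 0<ε =
        let η , 0<η , ηc≤ε = shrink ∣ c ∣ (0≤∣x∣ c) 0<ε
            δ , 0<δ , b = Df η 0<η
        in δ , 0<δ , λ s js near → ≤-trans (≈⇒≤ (∣∣-cong (factor s)))
          (≤-trans (∣xy∣≤ c (f s - f t - f′ * (s - t)))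
          (≤-trans (*-monoʳ-≤ (0≤∣x∣ c) (b s js near))
          (≤-trans (≈⇒≤ (regroup η ∣ c ∣ ∣ s - t ∣)) (*-monoˡ-≤ (0≤∣x∣ (s - t)) ηc≤ε))))
        where
        factor : ∀ s → c * f s - c * f t - c * f′ * (s - t) ≈ c * (f s - f t - f′ * (s - t))
        factor s = solve 5 (λ c a b d h → c :* a :- c :* b :- c :* d :* h := c :* (a :- b :- d :* h))
          refl c (f s) (f t) f′ (s - t)
        regroup : ∀ η c x → c * (η * x) ≈ η * c * x
        regroup = solve 3 (λ η c x → c :* (η :* x) := η :* c :* x) refl

      derivative-∙ : ∀ {n} (c : Vector Carrier n) {f : Fin n → Carrier → Carrier} {t f′} →
        (∀ i → HasDerivativeWithin J (f i) t (f′ i)) →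
        HasDerivativeWithin J (λ s → c ∙ (λ i → f i s)) t (c ∙ f′)
      derivative-∙ {zero}  c D = derivative-0 _
      derivative-∙ {suc n} c D = derivative-+ (derivative-* (c zero) (D zero)) (derivative-∙ (c ∘ suc) (D ∘ suc))

      -- The slack ε absorbs the error term of the derivative. One of the two points is always t,
      -- which is what real induction needs, and no bound on the derivative elsewhere enters.
      lipschitz-near : ∀ {f t f′ B ε} → HasDerivativeWithin J f t f′ → ∣ f′ ∣ ≤ B → 0# < ε →
        ∃[ δ ] 0# < δ × (∀ s → J s → ∣ s - t ∣ < δ → ∣ f s - f t ∣ ≤ (B + ε) * ∣ s - t ∣)
      lipschitz-near {f} {t} {f′} {B} {ε} D f′≤B 0<ε = let δ , 0<δ , b = D ε 0<ε in
        δ , 0<δ , λ s js near → ≤-trans (≈⇒≤ (∣∣-cong (split (f s - f t) (f′ * (s - t)))))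
          (≤-trans (∣x+y∣≤ _ _)
          (≤-trans (+-mono-≤ (b s js near) (≤-trans (∣xy∣≤ f′ (s - t)) (*-monoˡ-≤ (0≤∣x∣ (s - t)) f′≤B)))
            (≈⇒≤ (regroup ∣ s - t ∣))))
        where
        split : ∀ x d → x ≈ (x - d) + d
        split = solve 2 (λ x d → x := (x :- d) :+ d) refl
        regroup : ∀ h → ε * h + B * h ≈ (B + ε) * h
        regroup = solve 3 (λ e B h → e :* h :+ B :* h := (B :+ e) :* h) refl ε B

      -- `f′` need not be continuous, so nothing is integrated. For each ε > 0 the growth bound with
      -- slope B + ε is carried from a to b by real induction on `lipschitz-near`, after which ε
      -- tends to zero.
      meanValueInequality : ∀ {f f′ : Carrier → Carrier} {B} → a ≤ b → (∀ s → a ≤ s → s ≤ b → J s) →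
        (∀ s → a ≤ s → s ≤ b → HasDerivativeWithin J f s (f′ s)) →
        (∀ s → a ≤ s → s ≤ b → ∣ f′ s ∣ ≤ B) →
        ∣ f b - f a ∣ ≤ B * (b - a)
      meanValueInequality {a} {b} {f} {f′} {B} a≤b inJ D f′≤B = ≤-ε λ η 0<η →
        let ε , 0<ε , εh≤η = shrink (b - a) (≤⇒0≤ a≤b) 0<η in
        ≤-trans (growth ε 0<ε b a≤b ≤-refl) (≤-trans (≈⇒≤ (regroup ε (b - a))) (+-monoʳ-≤ εh≤η))
        where
        regroup : ∀ e h → (B + e) * h ≈ B * h + e * h
        regroup = solve 3 (λ B e h → (B :+ e) :* h := B :* h :+ e :* h) refl B

        growth : ∀ ε → 0# < ε → ∀ s → a ≤ s → s ≤ b → ∣ f s - f a ∣ ≤ (B + ε) * (s - a)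
        growth ε 0<ε = realInduction P
          (λ s → decidable-stable (∣ f s - f a ∣ ≤? (B + ε) * (s - a))) a≤b closed ahead
          where
          P : Carrier → Set
          P s = ∣ f s - f a ∣ ≤ (B + ε) * (s - a)

          chain : ∀ r s → ∣ f s - f r ∣ ≤ (B + ε) * (s - r) → P r → P s
          chain r s b Pr = ≤-trans (≈⇒≤ (∣∣-cong (telescope (f s) (f r) (f a))))
            (≤-trans (∣x+y∣≤ _ _) (≤-trans (+-mono-≤ b Pr) (≈⇒≤ (collect (B + ε)))))
            where
            telescope : ∀ s r a → s - a ≈ (s - r) + (r - a)
            telescope = solve 3 (λ s r a → s :- a := (s :- r) :+ (r :- a)) refl
            collect : ∀ L → L * (s - r) + L * (r - a) ≈ L * (s - a)
            collect L = solve 4 (λ s r a L → L :* (s :- r) :+ L :* (r :- a) := L :* (s :- a)) refl s r a L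

          closed : ∀ τ → a ≤ τ → τ ≤ b → (∀ s → a ≤ s → s < τ → P s) → P τ
          closed τ a≤τ τ≤b below =
            let δ , 0<δ , L = lipschitz-near (D τ a≤τ τ≤b) (f′≤B τ a≤τ τ≤b) 0<ε in
            [ far δ 0<δ L , same δ 0<δ L ]′ a≤τ
            where
            Lipschitz : Carrier → Set
            Lipschitz δ = ∀ s → J s → ∣ s - τ ∣ < δ → ∣ f s - f τ ∣ ≤ (B + ε) * ∣ s - τ ∣
            step : ∀ δ → Lipschitz δ → ∀ s → a ≤ s → s ≤ τ → τ - s < δ → ∣ f τ - f s ∣ ≤ (B + ε) * (τ - s)
            step δ L s a≤s s≤τ close = ≤-trans (≈⇒≤ (∣x-y∣≈∣y-x∣ (f τ) (f s)))
              (≤-trans (L s (inJ s a≤s (≤-trans s≤τ τ≤b)) (<-respˡ (sym ∣s-τ∣≈) close)) (≈⇒≤ (*-congˡ ∣s-τ∣≈)))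
              where
              ∣s-τ∣≈ : ∣ s - τ ∣ ≈ τ - s
              ∣s-τ∣≈ = trans (∣x-y∣≈∣y-x∣ s τ) (0≤⇒∣x∣≈x (≤⇒0≤ s≤τ))
            far : ∀ δ → 0# < δ → Lipschitz δ → a < τ → P τ
            far δ 0<δ L a<τ = let s , a≤s , s<τ , close = approach-from-below a<τ 0<δ in
              chain s τ (step δ L s a≤s (<⇒≤ s<τ) close) (below s a≤s s<τ)
            -- `f` is not assumed to respect `_≈_` either: even for τ ≈ a the estimate comes from
            -- the derivative at τ, applied at the point a.
            same : ∀ δ → 0# < δ → Lipschitz δ → a ≈ τ → P τ
            same δ 0<δ L a≈τ = step δ L a ≤-refl a≤τ (<-respˡ (trans (sym (-‿inverseʳ a)) (+-congʳ a≈τ)) 0<δ)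

          ahead : ∀ τ → a ≤ τ → τ < b → P τ → ∃[ δ ] 0# < δ × (∀ s → τ < s → s ≤ b → s - τ < δ → P s)
          ahead τ a≤τ τ<b Pτ =
            let δ , 0<δ , L = lipschitz-near (D τ a≤τ (<⇒≤ τ<b)) (f′≤B τ a≤τ (<⇒≤ τ<b)) 0<ε in
            δ , 0<δ , λ s τ<s s≤b close →
              let ∣s-τ∣≈ = 0≤⇒∣x∣≈x (≤⇒0≤ (<⇒≤ τ<s)) in
              chain τ s (≤-trans (L s (inJ s (≤-trans a≤τ (<⇒≤ τ<s)) s≤b) (<-respˡ (sym ∣s-τ∣≈) close))
                (≈⇒≤ (*-congˡ ∣s-τ∣≈))) Pτ

      derivative-0⇒constant : ∀ {f f′ : Carrier → Carrier} → a ≤ b → (∀ s → a ≤ s → s ≤ b → J s) →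
        (∀ s → a ≤ s → s ≤ b → HasDerivativeWithin J f s (f′ s)) →
        (∀ s → a ≤ s → s ≤ b → f′ s ≈ 0#) → f b ≈ f a
      derivative-0⇒constant {a} {b} {f} a≤b inJ D f′≈0 = x-y≈0⇒x≈y (∣x∣≤0⇒x≈0 (≤-resp refl (zeroˡ _)
        (meanValueInequality {f = f} a≤b inJ D λ s a≤s s≤b → ≈⇒≤ (trans (∣∣-cong (f′≈0 s a≤s s≤b)) (0≤⇒∣x∣≈x ≤-refl)))))

    -- With U the supremum of all ∣uᵢ∣, the mean value inequality from b backwards
    -- bounds every ∣uᵢ∣ by L (b - a) U ≤ U/2.
    backward-uniqueness : ∀ {J : Carrier → Set} {a b h L V} (u u′ : Fin n → Carrier → Carrier) →
      (∀ s → a ≤ s → s ≤ b → J s) →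
      (∀ i s → a ≤ s → s ≤ b → HasDerivativeWithin J (u i) s (u′ i s)) →
      (∀ i s → a ≤ s → s ≤ b → ∣ u i s ∣ ≤ V) →
      (∀ {U} s → a ≤ s → s ≤ b → (∀ i → ∣ u i s ∣ ≤ U) → ∀ i → ∣ u′ i s ∣ ≤ L * U) →
      0# ≤ L → h + h ≈ 1# → (b - a) * L ≤ h → (∀ i → u i b ≈ 0#) →
      ∀ i s → a ≤ s → s ≤ b → u i s ≈ 0#
    backward-uniqueness {n} {J} {a} {b} {h} {L} {V} u u′ inJ D u≤V u′≤LU 0≤L h+h≈1 short ub≈0 i s a≤s s≤b =
      ∣x∣≤0⇒x≈0 (≤-trans (u≤U i s a≤s s≤b) U≤0)
      where
      -- Adjoining zero makes the set visibly inhabited and its supremum nonnegative; `∣ V ∣` bounds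
      -- this extra value without a separate proof that V is nonnegative.
      Value : Carrier → Set
      Value x = x ≈ 0# ⊎ (∃[ s ] ∃[ i ] (a ≤ s × s ≤ b × x ≈ ∣ u i s ∣))

      ∣V∣-upper : IsUpperBound Value ∣ V ∣
      ∣V∣-upper x (inj₁ x≈0) = ≤-trans (≈⇒≤ x≈0) (0≤∣x∣ V)
      ∣V∣-upper x (inj₂ (s , i , a≤s , s≤b , x≈)) = ≤-trans (≈⇒≤ x≈) (≤-trans (u≤V i s a≤s s≤b) (x≤∣x∣ V))

      sup = supremum Value (0# , inj₁ refl) (∣ V ∣ , ∣V∣-upper)
      U = proj₁ sup
      U-upper : IsUpperBound Value U
      U-upper = proj₁ (proj₂ sup)
      U-least : ∀ c → IsUpperBound Value c → U ≤ c
      U-least = proj₂ (proj₂ sup)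

      0≤U : 0# ≤ U
      0≤U = U-upper 0# (inj₁ refl)

      u≤U : ∀ i s → a ≤ s → s ≤ b → ∣ u i s ∣ ≤ U
      u≤U i s a≤s s≤b = U-upper ∣ u i s ∣ (inj₂ (s , i , a≤s , s≤b , refl))

      u≤hU : ∀ i s → a ≤ s → s ≤ b → ∣ u i s ∣ ≤ h * U
      u≤hU i s a≤s s≤b =
        ≤-trans (≈⇒≤ (trans (sym (∣-x∣≈∣x∣ (u i s)))
          (∣∣-cong (sym (trans (+-congʳ (ub≈0 i)) (+-identityˡ (- u i s)))))))
        (≤-trans (meanValueInequality {f = u i} {f′ = u′ i} s≤b (λ r s≤r r≤b → inJ r (≤-trans a≤s s≤r) r≤b)
          (λ r s≤r r≤b → D i r (≤-trans a≤s s≤r) r≤b)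
          (λ r s≤r r≤b → u′≤LU r (≤-trans a≤s s≤r) r≤b (λ i → u≤U i r (≤-trans a≤s s≤r) r≤b) i))
        (≤-trans (≈⇒≤ (regroup L U (b - s)))
          (*-monoˡ-≤ 0≤U (≤-trans (*-monoˡ-≤ 0≤L (+-monoʳ-≤ (neg-mono-≤ a≤s))) short))))
        where
        regroup : ∀ L U d → L * U * d ≈ d * L * U
        regroup = solve 3 (λ L U d → L :* U :* d := d :* L :* U) refl

      hU-upper : IsUpperBound Value (h * U)
      hU-upper x (inj₁ x≈0) = ≤-trans (≈⇒≤ x≈0) (0≤* 0≤h 0≤U)
        where
        0≤h : 0# ≤ h
        0≤h = ≤-trans (0≤* (≤⇒0≤ (≤-trans a≤s s≤b)) 0≤L) short
      hU-upper x (inj₂ (s , i , a≤s , s≤b , x≈)) = ≤-trans (≈⇒≤ x≈) (u≤hU i s a≤s s≤b)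

      U≤0 : U ≤ 0#
      U≤0 = 0≤⇒≤ (0≤+ (≤⇒0≤ U≤hU) (≤⇒0≤ U≤hU))
        (trans (collect h U) (trans (+-congʳ (trans (*-congʳ h+h≈1) (*-identityˡ U))) (cancel U)))
        where
        U≤hU : U ≤ h * U
        U≤hU = U-least (h * U) hU-upper
        collect : ∀ h U → h * U - U + (h * U - U) ≈ (h + h) * U - (U + U)
        collect = solve 2 (λ h U → h :* U :- U :+ (h :* U :- U) := (h :+ h) :* U :- (U :+ U)) refl
        cancel : ∀ U → U - (U + U) ≈ 0# - U
        cancel = solve 1 (λ U → U :- (U :+ U) := con (+ 0) :- U) refl

  open Calculus

  -- Boundedness and continuity near a time.

  module Germ {J : Carrier → Set} (τ : ∃ J) where

    private variable
      n : ℕ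
      P Q : ∃ J → Set
      f g : ∃ J → Carrier

    -- Functions are taken on `∃ J` and not on `Carrier` because the inverse K is extracted from the
    -- equation at a time together with a proof that the time lies in `J`, and may depend on that
    -- proof.
    Near : (∃ J → Set) → Set
    Near P = ∃[ δ ] 0# < δ × (∀ d → ∣ proj₁ d - proj₁ τ ∣ < δ → P d)

    near-always : (∀ d → P d) → Near P
    near-always p = 1# , 0<1 , λ d _ → p d

    near-map : (∀ d → P d → Q d) → Near P → Near Q
    near-map h (δ , 0<δ , p) = δ , 0<δ , λ d close → h d (p d close)

    near-map₂ : ∀ {R : ∃ J → Set} → (∀ d → P d → Q d → R d) → Near P → Near Q → Near R
    near-map₂ h (δ₁ , 0<δ₁ , p) (δ₂ , 0<δ₂ , q) =
      let δ , δ≤δ₁ , δ≤δ₂ , 0<δ = minimum δ₁ δ₂ in δ , 0<δ 0<δ₁ 0<δ₂ ,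
      λ d close → h d (p d (<-≤-trans close δ≤δ₁)) (q d (<-≤-trans close δ≤δ₂))

    Bounded : (∃ J → Carrier) → Set
    Bounded f = ∃[ B ] Near (λ d → ∣ f d ∣ ≤ B)

    Small : (∃ J → Carrier) → Set
    Small f = ∀ ε → 0# < ε → Near (λ d → ∣ f d ∣ ≤ ε)

    Continuous : (∃ J → Carrier) → Set
    Continuous f = Small (λ d → f d - f τ)

    bounded-cong : (∀ d → f d ≈ g d) → Bounded f → Bounded g
    bounded-cong f≈g (B , b) = B , near-map (λ d → ≤-resp (∣∣-cong (f≈g d)) refl) b

    bounded-const : ∀ c → Bounded (λ _ → c)
    bounded-const c = ∣ c ∣ , near-always λ _ → ≤-refl

    bounded-+ : Bounded f → Bounded g → Bounded (λ d → f d + g d)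
    bounded-+ (B , b) (C , c) = B + C , near-map₂ (λ d p q → ≤-trans (∣x+y∣≤ _ _) (+-mono-≤ p q)) b c

    bounded-* : Bounded f → Bounded g → Bounded (λ d → f d * g d)
    bounded-* (B , b) (C , c) = B * C , near-map₂
      (λ d p q → ≤-trans (∣xy∣≤ _ _) (*-mono-≤ (0≤∣x∣ _) (0≤∣x∣ _) p q)) b c

    bounded-neg : Bounded f → Bounded (λ d → - f d)
    bounded-neg (B , b) = B , near-map (λ d → ≤-trans (∣-x∣≤∣x∣ _)) b

    bounded-∣∣ : Bounded f → Bounded (λ d → ∣ f d ∣)
    bounded-∣∣ (B , b) = B , near-map (λ d → ≤-resp (sym (0≤⇒∣x∣≈x (0≤∣x∣ _))) refl) b

    bounded-sum : {f : Fin n → ∃ J → Carrier} → (∀ i → Bounded (f i)) → Bounded (λ d → sum (λ i → f i d))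
    bounded-sum {zero}  b = bounded-const 0#
    bounded-sum {suc n} b = bounded-+ (b zero) (bounded-sum (b ∘ suc))

    small-cong : (∀ d → f d ≈ g d) → Small f → Small g
    small-cong f≈g s ε 0<ε = near-map (λ d → ≤-resp (∣∣-cong (f≈g d)) refl) (s ε 0<ε)

    small-0 : Small (λ _ → 0#)
    small-0 ε 0<ε = near-always λ _ → ≤-trans (≈⇒≤ (0≤⇒∣x∣≈x ≤-refl)) (<⇒≤ 0<ε)

    small-+ : Small f → Small g → Small (λ d → f d + g d)
    small-+ s t ε 0<ε = let h , 0<h , h+h≈ε = halve ε 0<ε in
      near-map₂ (λ d p q → ≤-trans (∣x+y∣≤ _ _) (≤-resp refl h+h≈ε (+-mono-≤ p q)))
      (s h 0<h) (t h 0<h)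

    small-neg : Small f → Small (λ d → - f d)
    small-neg s ε 0<ε = near-map (λ d → ≤-trans (∣-x∣≤∣x∣ _)) (s ε 0<ε)

    small-∣∣ : Small f → Small (λ d → ∣ f d ∣)
    small-∣∣ s ε 0<ε = near-map (λ d → ≤-resp (sym (0≤⇒∣x∣≈x (0≤∣x∣ _))) refl) (s ε 0<ε)

    small-bounded-* : Small f → Bounded g → Small (λ d → f d * g d)
    -- `Bounded` records no sign for B, so `shrink` is applied to `∣ B ∣`.
    small-bounded-* s (B , b) ε 0<ε = let δ , 0<δ , δB≤ε = shrink ∣ B ∣ (0≤∣x∣ B) 0<ε in
      near-map₂ (λ d p q → ≤-trans (∣xy∣≤ _ _)
        (≤-trans (*-mono-≤ (0≤∣x∣ _) (0≤∣x∣ _) p (≤-trans q (x≤∣x∣ B))) δB≤ε)) (s δ 0<δ) b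

    small-sum : {f : Fin n → ∃ J → Carrier} → (∀ i → Small (f i)) → Small (λ d → sum (λ i → f i d))
    small-sum {zero}  s = small-0
    small-sum {suc n} s = small-+ (s zero) (small-sum (s ∘ suc))

    continuous⇒bounded : Continuous f → Bounded f
    continuous⇒bounded {f} c = bounded-cong (λ d → solve 2 (λ x y → x :- y :+ y := x) refl (f d) (f τ))
      (bounded-+ (1# , c 1# 0<1) (bounded-const (f τ)))

    continuous-const : ∀ c → Continuous (λ _ → c)
    continuous-const c = small-cong (λ _ → sym (-‿inverseʳ c)) small-0

    continuous-* : Continuous f → Continuous g → Continuous (λ d → f d * g d)
    continuous-* {f} {g} cf cg = small-cong
      (λ d → solve 4 (λ x y a b → (x :- a) :* y :+ (y :- b) :* a := x :* y :- a :* b)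
        refl (f d) (g d) (f τ) (g τ))
      (small-+ (small-bounded-* cf (continuous⇒bounded cg)) (small-bounded-* cg (bounded-const (f τ))))

    continuous-sum : {f : Fin n → ∃ J → Carrier} → (∀ i → Continuous (f i)) → Continuous (λ d → sum (λ i → f i d))
    continuous-sum {f = f} c = small-cong (λ d → sum-∸ (λ i → f i d) (λ i → f i τ)) (small-sum c)

    differentiable⇒continuous : ∀ {h h′} → HasDerivativeWithin J h (proj₁ τ) h′ → Continuous (λ d → h (proj₁ d))
    differentiable⇒continuous {h} {h′} D = small-cong
      (λ d → solve 4 (λ a b c k → (a :- b :- k) :+ k := a :- b)
        refl (h (proj₁ d)) (h (proj₁ τ)) h′ (h′ * (proj₁ d - proj₁ τ)))
      (small-+ remainder-small (small-cong (λ _ → *-comm _ _) (small-bounded-* time-small (bounded-const h′))))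
      where
      time-small : Small (λ d → proj₁ d - proj₁ τ)
      time-small ε 0<ε = ε , 0<ε , λ d → <⇒≤
      remainder-small : Small (λ d → h (proj₁ d) - h (proj₁ τ) - h′ * (proj₁ d - proj₁ τ))
      remainder-small ε 0<ε = let δ , 0<δ , b = D 1# 0<1 in
        near-map₂ (λ d p q → ≤-trans p (≤-resp (sym (*-identityˡ _)) refl q))
        (δ , 0<δ , λ d → b (proj₁ d) (proj₂ d)) (time-small ε 0<ε)

    small-∥∥ₘ : ∀ {m} {M : ∃ J → Matrix m n} → (∀ i j → Small (λ d → M d i j)) → Small (λ d → ∥ M d ∥ₘ)
    small-∥∥ₘ s = small-sum λ i → small-sum λ j → small-∣∣ (s i j)

    -- The identity K = K₀ + K₀(M₀ − M)K, where the subscript denotes values at τ,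
    -- bounds the columns of K once ∥K₀∥∥M₀ − M∥ ≤ 1/2.
    inverse-bounded : (M K : ∃ J → Matrix n n) → (∀ d → IsInverse (M d) (K d)) →
      (∀ i j → Continuous (λ d → M d i j)) → ∀ i j → Bounded (λ d → K d i j)
    inverse-bounded {n} M K inv c i j = ∥ k₀ ∥ + ∥ k₀ ∥ , near-map bound (small h 0<h)
      where
      h = proj₁ (halve 1# 0<1)
      0<h = proj₁ (proj₂ (halve 1# 0<1))
      h+h≈1 = proj₂ (proj₂ (halve 1# 0<1))
      K₀ M₀ : Matrix n n
      K₀ = K τ
      M₀ = M τ
      e k₀ : Vector Carrier n
      e l = Id l j
      k₀ = K₀ *ᵥ e
      small : Small (λ d → ∥ M₀ -ₘ M d ∥ₘ * ∥ K₀ ∥ₘ)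
      small = small-bounded-* (small-∥∥ₘ λ i j → small-cong
        (λ d → solve 2 (λ x y → :- (x :- y) := y :- x) refl (M d i j) (M₀ i j)) (small-neg (c i j)))
        (bounded-const ∥ K₀ ∥ₘ)
      bound : ∀ d → ∣ ∥ M₀ -ₘ M d ∥ₘ * ∥ K₀ ∥ₘ ∣ ≤ h → ∣ K d i j ∣ ≤ ∥ k₀ ∥ + ∥ k₀ ∥
      bound d close = ≤-trans (∣vᵢ∣≤∥v∥ k i) (0≤⇒≤ (0≤+ (≤⇒0≤ half) (≤⇒0≤ half))
        (trans (solve 3 (λ h x y → y :- (x :- h :* x) :+ (y :- (x :- h :* x)) :=
                  y :+ y :- x :+ ((h :+ h) :* x :- x)) refl h (∥ k ∥) (∥ k₀ ∥))
          (trans (+-congˡ (trans (+-congʳ (trans (*-congʳ h+h≈1) (*-identityˡ _))) (-‿inverseʳ _))) (+-identityʳ _))))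
        where
        k : Vector Carrier n
        k l = K d l j
        D : Matrix n n
        D = M₀ -ₘ M d
        Dk≋ : D *ᵥ k ≋ (λ l → (M₀ *ᵥ k) l - e l)
        Dk≋ l = trans (-ₘ-*ᵥ M₀ (M d) k l) (+-congˡ (-‿cong (proj₁ (inv d) l j)))
        K₀M₀k≋k : K₀ *ᵥ (M₀ *ᵥ k) ≋ k
        K₀M₀k≋k l = trans (sym (*ᵥ-assoc K₀ M₀ k l)) (trans (*ᵥ-congʳ k (proj₂ (inv τ)) l) (Id-*ᵥ k l))
        k≋ : (λ l → (K₀ *ᵥ (D *ᵥ k)) l + k₀ l) ≋ k
        k≋ l = trans (+-congʳ (trans (*ᵥ-congˡ K₀ Dk≋ l) (trans (∙-∸ʳ (K₀ l) (M₀ *ᵥ k) e) (+-congʳ (K₀M₀k≋k l)))))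
          (solve 2 (λ x y → x :- y :+ y := x) refl (k l) (k₀ l))
        ∥K₀Dk∥≤ : ∥ K₀ *ᵥ (D *ᵥ k) ∥ ≤ h * ∥ k ∥
        ∥K₀Dk∥≤ = ≤-trans (∥*ᵥ∥≤ K₀ (D *ᵥ k)) (≤-trans (*-monoʳ-≤ 0≤∥ K₀ ∥ₘ (∥*ᵥ∥≤ D k))
          (≤-resp (solve 3 (λ a b c → b :* a :* c := a :* (b :* c)) refl (∥ K₀ ∥ₘ) (∥ D ∥ₘ) (∥ k ∥)) refl
            (*-monoˡ-≤ 0≤∥ k ∥ (≤-trans (x≤∣x∣ _) close))))
        half : ∥ k ∥ - h * ∥ k ∥ ≤ ∥ k₀ ∥
        half = 0≤⇒≤ (≤⇒0≤ (≤-trans (≤-resp (∥∥-cong k≋) refl (∥+∥≤ (K₀ *ᵥ (D *ᵥ k)) k₀)) (+-monoˡ-≤ ∥K₀Dk∥≤)))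
          (solve 3 (λ x y z → y :+ z :- x := z :- (x :- y)) refl (∥ k ∥) (h * ∥ k ∥) (∥ k₀ ∥))

  -- Semidefinite kernels, Schur complements and coercivity.

  module DefiniteForms where

    private variable
      n : ℕ

    x²≤0⇒x≈0 : ∀ {x} → x * x ≤ 0# → x ≈ 0#
    x²≤0⇒x≈0 {x} x²≤0 with compare x 0#
    ... | tri≈ _ x≈0 _ = x≈0
    ... | tri> _ _ 0<x = contradiction (*-pos 0<x 0<x) (≤⇒≯ x²≤0)
    ... | tri< x<0 _ _ = contradiction (<-respʳ (solve 1 (λ x → (con (+ 0) :- x) :* (con (+ 0) :- x) := x :* x) refl x)
      (*-pos (<⇒0< x<0) (<⇒0< x<0))) (≤⇒≯ x²≤0)

    ∣x∣²≈x² : ∀ x → ∣ x ∣ * ∣ x ∣ ≈ x * x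
    ∣x∣²≈x² x with ∣x∣-cases x
    ... | inj₁ (_ , e) = trans (*-cong e e) (solve 1 (λ x → :- x :* :- x := x :* x) refl x)
    ... | inj₂ (_ , e) = *-cong e e

    -- With w = Mv, the form at v - εw is v·Mv - 2ε w·w + ε² w·Mw. It is nonnegative while v·Mv ≤ 0,
    -- so after division by ε, 2 w·w ≤ ε w·Mw for every ε > 0, which forces w = 0.
    semidefinite-kernel : {M : Matrix n n} → IsSymmetric M → (∀ w → 0# ≤ w ∙ (M *ᵥ w)) →
      ∀ v → v ∙ (M *ᵥ v) ≤ 0# → M *ᵥ v ≋ 0ᵥ
    semidefinite-kernel {n} {M} symM psd v vMv≤0 i =
      x²≤0⇒x≈0 (≤-trans (term≤sum (λ i → 0≤x² (w i)) i) (≤-ε λ η 0<η → ww≤η η 0<η))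
      where
      w : Vector Carrier n
      w = M *ᵥ v
      q = w ∙ (M *ᵥ w)

      expand : ∀ ε → let u = λ i → v i - ε * w i in
        u ∙ (M *ᵥ u) ≈ v ∙ w - (ε + ε) * (w ∙ w) + ε * (ε * q)
      expand ε = begin
        u ∙ (M *ᵥ u)                    ≈⟨ linear u ⟩
        u ∙ w - ε * (u ∙ (M *ᵥ w))      ≈⟨ +-cong (left w) (-‿cong (*-congˡ (left (M *ᵥ w)))) ⟩
        (v ∙ w - ε * (w ∙ w)) - ε * (v ∙ (M *ᵥ w) - ε * q)
          ≈⟨ +-congˡ (-‿cong (*-congˡ (+-congʳ (∙-symmetric symM v w)))) ⟩
        (v ∙ w - ε * (w ∙ w)) - ε * (w ∙ w - ε * q)
          ≈⟨ solve 4 (λ a b e q → a :- e :* b :- e :* (b :- e :* q) :=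
               a :- (e :+ e) :* b :+ e :* (e :* q)) refl (v ∙ w) (w ∙ w) ε q ⟩
        v ∙ w - (ε + ε) * (w ∙ w) + ε * (ε * q) ∎
        where
        open SetoidReasoning setoid
        u : Vector Carrier n
        u i = v i - ε * w i
        expandʳ : (p : Vector Carrier n) → p ∙ u ≈ p ∙ v - ε * (p ∙ w)
        expandʳ p = trans (∙-∸ʳ p v (λ i → ε * w i)) (+-congˡ (-‿cong (∙-*ʳ p w ε)))
        left : (p : Vector Carrier n) → u ∙ p ≈ v ∙ p - ε * (w ∙ p)
        left p = trans (∙-comm u p) (trans (expandʳ p) (+-cong (∙-comm p v) (-‿cong (*-congˡ (∙-comm p w)))))
        linear : (p : Vector Carrier n) → p ∙ (M *ᵥ u) ≈ p ∙ w - ε * (p ∙ (M *ᵥ w))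
        linear p = trans (∙-cong {u = p} (λ _ → refl) (λ i → expandʳ (M i)))
          (trans (∙-∸ʳ p w (λ i → ε * (M *ᵥ w) i)) (+-congˡ (-‿cong (∙-*ʳ p (M *ᵥ w) ε))))

      ww≤η : ∀ η → 0# < η → w ∙ w ≤ 0# + η
      ww≤η η 0<η = let ε , 0<ε , εq≤η = shrink ∣ q ∣ (0≤∣x∣ q) 0<η in
        0≤⇒≤ (0≤+ (0≤-cancelˡ 0<ε (bound ε 0<ε εq≤η)) (0≤sum (λ i → 0≤x² (w i)))) (regroup (w ∙ w) η)
        where
        regroup : ∀ W η → (η - W - W) + W ≈ 0# + η - W
        regroup = solve 2 (λ W η → (η :- W :- W) :+ W := con (+ 0) :+ η :- W) refl
        collect : ∀ a b e q → (a - (e + e) * b + e * (e * q)) + (0# - a) + e * (η - e * q) ≈ e * (η - b - b)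
        collect a b e q = solve 5 (λ a b e q n → (a :- (e :+ e) :* b :+ e :* (e :* q)) :+
          (con (+ 0) :- a) :+ e :* (n :- e :* q) :=
            e :* (n :- b :- b)) refl a b e q η
        bound : ∀ ε → 0# < ε → ε * ∣ q ∣ ≤ η → 0# ≤ ε * (η - (w ∙ w) - (w ∙ w))
        bound ε 0<ε εq≤η = ≤-trans
          (0≤+ (0≤+ (≤-trans (psd (λ i → v i - ε * w i)) (≈⇒≤ (expand ε))) (≤⇒0≤ vMv≤0))
            (0≤* (<⇒≤ 0<ε) (≤⇒0≤ (≤-trans (*-monoʳ-≤ (<⇒≤ 0<ε) (x≤∣x∣ q)) εq≤η))))
          (≈⇒≤ (collect (v ∙ w) (w ∙ w) ε q))

    Positive : Matrix n n → Set
    Positive M = ∀ v → ¬ (v ≋ 0ᵥ) → 0# < v ∙ (M *ᵥ v)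

    -- One step of symmetric elimination with pivot a: `β` is the first row divided by a, and `S` is
    -- the Schur complement of a. The reciprocal enters as an r with a r ≈ 1.
    module SchurComplement {n} (M : Matrix (suc n) (suc n)) (symM : IsSymmetric M)
      {r} (ar≈1 : M zero zero * r ≈ 1#) where

      a = M zero zero

      row β : Vector Carrier n
      row j = M zero (suc j)
      β j = r * row j

      S : Matrix n n
      S i j = M (suc i) (suc j) - M (suc i) zero * β j

      S-symmetric : IsSymmetric S
      S-symmetric i j = +-cong (symM (suc i) (suc j)) (-‿cong (trans
        (*-cong (sym (symM (suc j) zero)) (*-congˡ (sym (symM zero (suc i)))))
        (solve 3 (λ x y r → x :* (r :* y) := y :* (r :* x)) refl (row j) (M (suc i) zero) r)))

      -- With p = row·w and q the form of the lower block at w, this is a x² + 2xp + q = a (x +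
      -- p/a)² + (q - p²/a).
      completeSquare : ∀ v → let x = v zero; w = v ∘ suc in
        v ∙ (M *ᵥ v) ≈ a * ((x + β ∙ w) * (x + β ∙ w)) + w ∙ (S *ᵥ w)
      completeSquare v = begin
        x * (a * x + p) + w ∙ (λ i → col i * x + (D *ᵥ w) i)
          ≈⟨ +-congˡ (trans (∙-+ʳ w (λ i → col i * x) (D *ᵥ w)) (+-congʳ wcx≈)) ⟩
        x * (a * x + p) + (x * p + q)
          -- The solver cannot use a r ≈ 1. The inserted factors `1#` mark the places where a r is
          -- substituted in the next step, after which the square is again a pure ring identity.
          ≈⟨ solve 5 (λ x a p q r → x :* (a :* x :+ p) :+ (x :* p :+ q) :=
               a :* (x :* x) :+ (x :* p :+ x :* p) :* con (+ 1) :+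
               r :* p :* p :* con (+ 1) :+ (q :- p :* (r :* p))) refl x a p q r ⟩
        a * (x * x) + (x * p + x * p) * 1# + r * p * p * 1# + (q - p * (r * p))
          ≈⟨ +-congʳ (+-cong (+-congˡ (*-congˡ ar≈1)) (*-congˡ ar≈1)) ⟨
        a * (x * x) + (x * p + x * p) * (a * r) + r * p * p * (a * r) + (q - p * (r * p))
          ≈⟨ solve 5 (λ x a p q r → a :* (x :* x) :+ (x :* p :+ x :* p) :* (a :* r) :+
               r :* p :* p :* (a :* r) :+ (q :- p :* (r :* p)) :=
               a :* ((x :+ r :* p) :* (x :+ r :* p)) :+ (q :- p :* (r :* p))) refl x a p q r ⟩
        a * ((x + r * p) * (x + r * p)) + (q - p * (r * p))
          ≈⟨ +-cong (*-congˡ (*-cong (+-congˡ βw≈) (+-congˡ βw≈))) wSw≈ ⟨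
        a * ((x + β ∙ w) * (x + β ∙ w)) + w ∙ (S *ᵥ w) ∎
        where
        open SetoidReasoning setoid
        x = v zero
        w col : Vector Carrier n
        w = v ∘ suc
        col i = M (suc i) zero
        D : Matrix n n
        D i j = M (suc i) (suc j)
        p = row ∙ w
        q = w ∙ (D *ᵥ w)
        wcol≈ : w ∙ col ≈ p
        wcol≈ = trans (∙-comm w col) (∙-cong {v = w} (λ i → symM zero (suc i)) λ _ → refl)
        wcx≈ : w ∙ (λ i → col i * x) ≈ x * p
        wcx≈ = trans (∙-cong {u = w} (λ _ → refl) (λ i → *-comm (col i) x)) (trans (∙-*ʳ w col x) (*-congˡ wcol≈))
        βw≈ : β ∙ w ≈ r * p
        βw≈ = trans (∙-comm β w) (trans (∙-*ʳ w row r) (*-congˡ (∙-comm w row)))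
        Sw≈ : S *ᵥ w ≋ (λ i → (D *ᵥ w) i - (r * p) * col i)
        Sw≈ i = trans (-ₘ-*ᵥ D (λ i j → col i * β j) w i) (+-congˡ (-‿cong
          (trans (∙-comm (λ j → col i * β j) w) (trans (∙-*ʳ w β (col i)) (trans (*-comm _ _)
            (*-congʳ (trans (∙-comm w β) βw≈)))))))
        wSw≈ : w ∙ (S *ᵥ w) ≈ q - p * (r * p)
        wSw≈ = trans (∙-cong {u = w} (λ _ → refl) Sw≈) (trans (∙-∸ʳ w (D *ᵥ w) (λ i → (r * p) * col i))
          (+-congˡ (-‿cong (trans (∙-*ʳ w col (r * p)) (trans (*-congˡ wcol≈) (*-comm _ _))))))

      -- Giving v the first coordinate -(β·w) makes the completed square vanish, so the form of `S`
      -- at w is a value of the form of `M`.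
      S-positive : Positive M → Positive S
      S-positive pos w w≉0 = <-respʳ
        (trans (completeSquare v) (trans (+-congʳ (trans (*-congˡ (*-congʳ (-‿inverseˡ (β ∙ w))))
          (trans (*-congˡ (zeroˡ _)) (zeroʳ a)))) (+-identityˡ _)))
        (pos v λ v≋0 → w≉0 (v≋0 ∘ suc))
        where
        v : Vector Carrier (suc n)
        v = (- (β ∙ w)) ∷ w

    diagonal-positive : {M : Matrix n n} → Positive M → ∀ i → 0# < M i i
    diagonal-positive {n} {M} pos i = <-respʳ
      (trans (sum-Id i (M *ᵥ Id i)) (trans (∙-comm (M i) (Id i)) (sum-Id i (M i))))
      -- The entries of the basis vector `Id i` sum to `1#`; if it vanished they would sum to `0#`.
      (pos (Id i) λ e≋0 → 1≉0 (trans (sym (sum-Id i (λ _ → 1#)))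
        (trans (sum-cong λ j → *-congʳ {x = 1#} (e≋0 j)) (sum-zero {n = n} {f = λ j → 0# * 1#} λ _ → zeroˡ 1#))))

    -- Induction on the dimension: the completed square controls the first coordinate up to a
    -- multiple of ∥ w ∥, and the Schur complement is coercive in w. A single c for all v is what
    -- later makes definiteness survive small perturbations of the matrix.
    coercive : (M : Matrix n n) → IsSymmetric M → Positive M →
      ∃[ c ] 0# < c × (∀ v → c * (∥ v ∥ * ∥ v ∥) ≤ v ∙ (M *ᵥ v))
    coercive {zero} M symM pos = 1# , 0<1 , λ v → ≈⇒≤ (trans (*-congˡ (zeroˡ 0#)) (zeroʳ 1#))
    coercive {suc n} M symM pos =
      let r , 0<r , ar≈1 = reciprocal (diagonal-positive {M = M} pos zero)
          open SchurComplement M symM ar≈1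
          μ , 0<μ , coerc = coercive S S-symmetric (S-positive pos)
      in extend ar≈1 0<μ coerc
      where
      extend : ∀ {r μ} (ar≈1 : M zero zero * r ≈ 1#) → 0# < μ → let open SchurComplement M symM ar≈1 in
        (∀ w → μ * (∥ w ∥ * ∥ w ∥) ≤ w ∙ (S *ᵥ w)) →
        ∃[ c ] 0# < c × (∀ v → c * (∥ v ∥ * ∥ v ∥) ≤ v ∙ (M *ᵥ v))
      extend {r} {μ} ar≈1 0<μ coerc =
        -- With y = x + β·w and B = 1 + ∥ β ∥ one has ∥ v ∥ ≤ ∣ y ∣ + B ∥ w ∥, hence c ∥ v ∥² ≤ 2c
        -- y² + 2cB² ∥ w ∥². The two constraints on c are therefore 2c ≤ a and 2cB² ≤ μ.
        let h , 0<h , h+h≈a = halve a (diagonal-positive {M = M} pos zero)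
            k , 0<k , kB≤μ = shrink (B * B + B * B) (0≤+ (0≤x² B) (0≤x² B)) 0<μ
            c , c≤h , c≤k , 0<c = minimum h k
        in c , 0<c 0<h 0<k , bound c (<⇒≤ (0<c 0<h 0<k)) (≤-trans (+-mono-≤ c≤h c≤h) (≈⇒≤ h+h≈a))
             (≤-trans (*-monoˡ-≤ (0≤+ (0≤x² B) (0≤x² B)) c≤k) kB≤μ)
        where
        open SchurComplement M symM ar≈1
        B = 1# + ∥ β ∥
        bound : ∀ c → 0# ≤ c → c + c ≤ a → c * (B * B + B * B) ≤ μ →
          ∀ v → c * (∥ v ∥ * ∥ v ∥) ≤ v ∙ (M *ᵥ v)
        bound c 0≤c 2c≤a 2cB²≤μ v = ≤-trans
          (*-monoʳ-≤ 0≤c (≤-trans (*-mono-≤ 0≤∥ v ∥ 0≤∥ v ∥ ∥v∥≤ ∥v∥≤) ([s+t]²≤ s t)))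
          (≤-trans main (≈⇒≤ (sym (completeSquare v))))
          where
          x = v zero
          w : Vector Carrier n
          w = v ∘ suc
          y = x + β ∙ w
          s = ∣ y ∣
          t = B * ∥ w ∥
          cancel : ∀ x b → x ≈ (x + b) + - b
          cancel = solve 2 (λ x b → x := x :+ b :+ :- b) refl
          factor : ∀ s b w → s + b * w + w ≈ s + (1# + b) * w
          factor = solve 3 (λ s b w → s :+ b :* w :+ w := s :+ (con (+ 1) :+ b) :* w) refl
          ∥v∥≤ : ∣ x ∣ + ∥ w ∥ ≤ s + t
          ∥v∥≤ = ≤-trans (+-monoˡ-≤ (≤-trans (≈⇒≤ (∣∣-cong (cancel x (β ∙ w))))
              (≤-trans (∣x+y∣≤ y (- (β ∙ w))) (+-monoʳ-≤ (≤-trans (∣-x∣≤∣x∣ (β ∙ w)) (∣∙∣≤ β w))))))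
            (≈⇒≤ (factor s (∥ β ∥) (∥ w ∥)))
          [s+t]²≤ : ∀ s t → (s + t) * (s + t) ≤ (s * s + s * s) + (t * t + t * t)
          [s+t]²≤ s t = 0≤⇒≤ (0≤x² (s - t)) (solve 2 (λ s t → (s :- t) :* (s :- t) :=
            (s :* s :+ s :* s) :+ (t :* t :+ t :* t) :- (s :+ t) :* (s :+ t)) refl s t)
          distribute : ∀ s b w → c * ((s * s + s * s) + (b * w * (b * w) + b * w * (b * w))) ≈
              (c + c) * (s * s) + c * (b * b + b * b) * (w * w)
          distribute s b w = solve 4
            (λ c s b w → c :* ((s :* s :+ s :* s) :+ (b :* w :* (b :* w) :+ b :* w :* (b :* w))) :=
              (c :+ c) :* (s :* s) :+ c :* (b :* b :+ b :* b) :* (w :* w)) refl c s b w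
          main : c * ((s * s + s * s) + (t * t + t * t)) ≤ a * (y * y) + w ∙ (S *ᵥ w)
          main = ≤-trans (≈⇒≤ (distribute s B (∥ w ∥))) (+-mono-≤
            (≤-trans (*-monoˡ-≤ (0≤x² s) 2c≤a) (≈⇒≤ (*-congˡ (∣x∣²≈x² y))))
            (≤-trans (*-monoˡ-≤ (0≤x² (∥ w ∥)) 2cB²≤μ) (coerc w)))

  open DefiniteForms

  -- The factored dynamics and the quantities they conserve.

  module AnsatzFlow {m n} {C : Matrix n n} {A : Fin m → Matrix n n}
    (symC : IsSymmetric C) (symA : ∀ ℓ → IsSymmetric (A ℓ))
    {J : Carrier → Set} (interval : IsTimeInterval J)
    {X : Carrier → Matrix n n} (solution : IsSolution C A J X) where

    open IsTimeInterval interval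
    open IsSolution solution

    K : ∃ J → Matrix m m
    K (t , jt) = proj₁ (equation t jt)

    K-inverse : ∀ d → IsInverse (𝒜 *ₘ G (proj₁ d) *ₘ 𝒜 ᵀ) (K d)
    K-inverse (t , jt) = proj₁ (proj₂ (equation t jt))

    Gc : ∃ J → Vector Carrier (n ℕ.* n)
    Gc d = G (proj₁ d) *ᵥ vec C

    y : ∃ J → Vector Carrier m
    y d = K d *ᵥ (𝒜 *ᵥ Gc d)

    -- The vectorised dual slack matrix S = C - Σ y_ℓ A_ℓ, with `y` as multipliers.
    z : ∃ J → Vector Carrier (n ℕ.* n)
    z d k = vec C k - (𝒜 ᵀ *ᵥ y d) k

    vecẊ≋ : ∀ d → vec (Ẋ (proj₁ d)) ≋ -ᵥ (G (proj₁ d) *ᵥ z d)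
    vecẊ≋ d@(t , jt) k = trans (proj₂ (proj₂ (equation t jt)) k) (-‿cong (begin
      ((Id -ₘ G t *ₘ 𝒜 ᵀ *ₘ K d *ₘ 𝒜) *ᵥ Gc d) k
        ≈⟨ -ₘ-*ᵥ Id (G t *ₘ 𝒜 ᵀ *ₘ K d *ₘ 𝒜) (Gc d) k ⟩
      (Id *ᵥ Gc d) k - ((G t *ₘ 𝒜 ᵀ *ₘ K d *ₘ 𝒜) *ᵥ Gc d) k
        ≈⟨ +-cong (Id-*ᵥ (Gc d) k) (-‿cong (trans (*ᵥ-assoc (G t *ₘ 𝒜 ᵀ *ₘ K d) 𝒜 (Gc d) k)
             (trans (*ᵥ-assoc (G t *ₘ 𝒜 ᵀ) (K d) (𝒜 *ᵥ Gc d) k) (*ᵥ-assoc (G t) (𝒜 ᵀ) (y d) k)))) ⟩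
      Gc d k - (G t *ᵥ (𝒜 ᵀ *ᵥ y d)) k
        ≈⟨ ∙-∸ʳ (G t k) (vec C) (𝒜 ᵀ *ᵥ y d) ⟨
      (G t *ᵥ z d) k ∎))
      where open SetoidReasoning setoid

    -- Since K is a right inverse of 𝒜G𝒜ᵀ, the multipliers satisfy (𝒜G𝒜ᵀ) y = 𝒜G vec(C). So the
    -- velocity is tangent to the affine space of linearly feasible matrices.
    𝒜Gz≋0 : ∀ d → 𝒜 *ᵥ (G (proj₁ d) *ᵥ z d) ≋ 0ᵥ
    𝒜Gz≋0 d@(t , jt) ℓ = begin
      𝒜 ℓ ∙ (G t *ᵥ z d)
        ≈⟨ ∙-cong {u = 𝒜 ℓ} (λ _ → refl) (λ k → ∙-∸ʳ (G t k) (vec C) (𝒜 ᵀ *ᵥ y d)) ⟩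
      𝒜 ℓ ∙ (λ k → Gc d k - (G t *ᵥ (𝒜 ᵀ *ᵥ y d)) k)
        ≈⟨ ∙-∸ʳ (𝒜 ℓ) (Gc d) (G t *ᵥ (𝒜 ᵀ *ᵥ y d)) ⟩
      (𝒜 *ᵥ Gc d) ℓ - (𝒜 *ᵥ (G t *ᵥ (𝒜 ᵀ *ᵥ y d))) ℓ
        ≈⟨ +-congˡ (-‿cong (trans (*ᵥ-assoc (𝒜 *ₘ G t) (𝒜 ᵀ) (y d) ℓ) (*ᵥ-assoc 𝒜 (G t) (𝒜 ᵀ *ᵥ y d) ℓ))) ⟨
      (𝒜 *ᵥ Gc d) ℓ - ((𝒜 *ₘ G t *ₘ 𝒜 ᵀ) *ᵥ y d) ℓ
        ≈⟨ +-congˡ (-‿cong (trans (sym (*ᵥ-assoc (𝒜 *ₘ G t *ₘ 𝒜 ᵀ) (K d) (𝒜 *ᵥ Gc d) ℓ))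
             (trans (*ᵥ-congʳ (𝒜 *ᵥ Gc d) (proj₁ (K-inverse d)) ℓ) (Id-*ᵥ (𝒜 *ᵥ Gc d) ℓ)))) ⟩
      (𝒜 *ᵥ Gc d) ℓ - (𝒜 *ᵥ Gc d) ℓ
        ≈⟨ -‿inverseʳ ((𝒜 *ᵥ Gc d) ℓ) ⟩
      0# ∎
      where open SetoidReasoning setoid

    𝒜vecX-constant : ∀ t → J t → 𝒜 *ᵥ vec (X t) ≋ 𝒜 *ᵥ vec (X 0#)
    𝒜vecX-constant t jt ℓ = derivative-0⇒constant
      {f = λ s → (𝒜 *ᵥ vec (X s)) ℓ} {f′ = λ s → (𝒜 *ᵥ vec (Ẋ s)) ℓ} (nonneg jt) inJ
      (λ s 0≤s s≤t → derivative-∙ (𝒜 ℓ) λ k → differentiable s (inJ s 0≤s s≤t) (remainder {n} n k) (quotient n k))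
      (λ s 0≤s s≤t → 𝒜Ẋ≈0 (s , inJ s 0≤s s≤t))
      where
      inJ : ∀ s → 0# ≤ s → s ≤ t → J s
      inJ s 0≤s s≤t = downClosed 0≤s s≤t jt
      𝒜Ẋ≈0 : ∀ d → 𝒜 ℓ ∙ vec (Ẋ (proj₁ d)) ≈ 0#
      𝒜Ẋ≈0 d = begin
        𝒜 ℓ ∙ vec (Ẋ (proj₁ d))              ≈⟨ ∙-cong {u = 𝒜 ℓ} (λ _ → refl) (vecẊ≋ d) ⟩
        𝒜 ℓ ∙ (-ᵥ (G (proj₁ d) *ᵥ z d))      ≈⟨ ∙-negʳ (𝒜 ℓ) (G (proj₁ d) *ᵥ z d) ⟩
        - (𝒜 ℓ ∙ (G (proj₁ d) *ᵥ z d))       ≈⟨ -‿cong (𝒜Gz≋0 d ℓ) ⟩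
        - 0#                                  ≈⟨ solve 0 (:- con (+ 0) := con (+ 0)) refl ⟩
        0# ∎
        where open SetoidReasoning setoid

    -- Z is the transpose of C - Σ y_ℓ A_ℓ, so that Ẋ = - X Zᵀ Xᵀ.
    Z T : ∃ J → Matrix n n
    Z d p q = z d (combine p q)
    T d i p = X (proj₁ d) i ∙ Z d p

    Z-symmetric : ∀ d → IsSymmetric (Z d)
    Z-symmetric d p q = +-cong (flip symC) (-‿cong (∙-cong {v = y d} (λ ℓ → flip (symA ℓ)) (λ _ → refl)))
      where
      flip : ∀ {M : Matrix n n} → IsSymmetric M → vec M (combine q p) ≈ vec M (combine p q)
      flip {M} symM = trans (reflexive (vec-combine M p q))
        (trans (symM q p) (reflexive (≡.sym (vec-combine M q p))))

    Ẋ≈ : ∀ d i j → Ẋ (proj₁ d) i j ≈ - (X (proj₁ d) j ∙ T d i)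
    Ẋ≈ d@(t , jt) i j = trans (reflexive (≡.sym (vec-combine (Ẋ t) i j)))
      (trans (vecẊ≋ d (combine j i)) (-‿cong (⊗-combine (X t) (X t) (z d) i j)))

    -- X Zᵀ Xᵀ is a congruence of a symmetric matrix, hence symmetric whatever X is; deducing the
    -- symmetry of X from it is therefore not circular.
    Ẋ-symmetric : ∀ d → IsSymmetric (Ẋ (proj₁ d))
    Ẋ-symmetric d@(t , jt) i j = trans (Ẋ≈ d j i) (trans (-‿cong (∙-symmetric′ (X t i) (X t j))) (sym (Ẋ≈ d i j)))
      where
      ∙-symmetric′ : ∀ u v → u ∙ (λ p → v ∙ Z d p) ≈ v ∙ (λ p → u ∙ Z d p)
      ∙-symmetric′ u v = trans (∙-cong {u = u} (λ _ → refl) (λ p → ∙-comm v (Z d p)))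
        (trans (∙-symmetric (Z-symmetric d) u v) (∙-cong {u = v} (λ _ → refl) (λ p → ∙-comm (Z d p) u)))

    X-symmetric : IsSymmetric (X 0#) → ∀ t → J t → IsSymmetric (X t)
    X-symmetric symX₀ t jt i j = x-y≈0⇒x≈y (trans (minus (X t j i) (X t i j))
      (trans (derivative-0⇒constant {f = λ s → X s j i + - 1# * X s i j}
        {f′ = λ s → Ẋ s j i + - 1# * Ẋ s i j} (nonneg jt) inJ
        (λ s 0≤s s≤t → derivative-+ (differentiable s (inJ s 0≤s s≤t) j i)
          (derivative-* (- 1#) (differentiable s (inJ s 0≤s s≤t) i j)))
        (λ s 0≤s s≤t → cancel (Ẋ-symmetric (s , inJ s 0≤s s≤t) i j)))
      (cancel (symX₀ i j))))
      where
      inJ : ∀ s → 0# ≤ s → s ≤ t → J s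
      inJ s 0≤s s≤t = downClosed 0≤s s≤t jt
      minus : ∀ x y → x - y ≈ x + - 1# * y
      minus = solve 2 (λ x y → x :- y := x :+ (:- con (+ 1)) :* y) refl
      cancel : ∀ {x y} → x ≈ y → x + - 1# * y ≈ 0#
      cancel {x} {y} x≈y = trans (sym (minus x y)) (trans (+-congʳ x≈y) (-‿inverseʳ y))

  -- Positive definiteness along the flow.

  module Positivity {m n} {C : Matrix n n} {A : Fin m → Matrix n n}
    (symC : IsSymmetric C) (symA : ∀ ℓ → IsSymmetric (A ℓ))
    {J : Carrier → Set} (interval : IsTimeInterval J)
    {X : Carrier → Matrix n n} (solution : IsSolution C A J X)
    (symX₀ : IsSymmetric (X 0#)) (posX₀ : Positive (X 0#)) where

    open IsTimeInterval interval
    open IsSolution solution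
    open AnsatzFlow symC symA interval solution

    module _ (τ : ∃ J) where

      open Germ {J} τ

      X-continuous : ∀ i j → Continuous (λ d → X (proj₁ d) i j)
      X-continuous i j = differentiable⇒continuous (differentiable (proj₁ τ) (proj₂ τ) i j)

      G-continuous : ∀ r s → Continuous (λ d → G (proj₁ d) r s)
      G-continuous r s = continuous-* (X-continuous (quotient n r) (quotient n s))
        (X-continuous (remainder {n} n r) (remainder {n} n s))

      𝒜G𝒜ᵀ-continuous : ∀ i j → Continuous (λ d → (𝒜 *ₘ G (proj₁ d) *ₘ 𝒜 ᵀ) i j)
      𝒜G𝒜ᵀ-continuous i j = continuous-sum λ s →
        continuous-* (continuous-sum λ r → continuous-* (continuous-const (𝒜 i r)) (G-continuous r s))
          (continuous-const (𝒜 j s))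

      -- This rests on the inverse at τ itself, available because the equation holds there. At a
      -- limit of times of definiteness, definiteness could not yet supply it.
      K-bounded : ∀ i j → Bounded (λ d → K d i j)
      K-bounded = inverse-bounded (λ d → 𝒜 *ₘ G (proj₁ d) *ₘ 𝒜 ᵀ) K K-inverse 𝒜G𝒜ᵀ-continuous

      y-bounded : ∀ ℓ → Bounded (λ d → y d ℓ)
      y-bounded ℓ = bounded-sum λ k → bounded-* (K-bounded ℓ k)
        (bounded-sum λ r → bounded-* (bounded-const (𝒜 k r))
          (bounded-sum λ s → bounded-* (continuous⇒bounded (G-continuous r s)) (bounded-const (vec C s))))

      z-bounded : ∀ k → Bounded (λ d → z d k)
      z-bounded k = bounded-+ (bounded-const (vec C k))
        (bounded-neg (bounded-sum λ ℓ → bounded-* (bounded-const (𝒜 ℓ k)) (y-bounded ℓ)))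

      -- `T` is X S, the coefficient matrix of the linear equation satisfied by Xv.
      T-bounded : Bounded (λ d → ∥ T d ∥ₘ)
      T-bounded = bounded-sum λ i → bounded-sum λ (p : Fin n) → bounded-∣∣
        (bounded-sum λ q → bounded-* (continuous⇒bounded (X-continuous i q)) (z-bounded (combine p q)))

      form-continuous : ∀ w → Continuous (λ d → w ∙ (X (proj₁ d) *ᵥ w))
      form-continuous w = continuous-sum λ i → continuous-* (continuous-const (w i))
        (continuous-sum λ j → continuous-* (X-continuous i j) (continuous-const (w j)))

      Xv-bounded : ∀ v → Bounded (λ d → ∥ X (proj₁ d) *ᵥ v ∥)
      Xv-bounded v = bounded-sum λ i → bounded-∣∣
        (bounded-sum λ j → bounded-* (continuous⇒bounded (X-continuous i j)) (bounded-const (v j)))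

      X-difference-small : Small (λ d → ∥ X (proj₁ d) -ₘ X (proj₁ τ) ∥ₘ)
      X-difference-small = small-∥∥ₘ X-continuous

    -- If the form at w were negative at t, continuity would keep it negative slightly earlier,
    -- where it is positive: a negative value at t already shows that w is nonzero.
    0≤form : ∀ {t} → J t → 0# < t → (∀ s → 0# ≤ s → s < t → Positive (X s)) → ∀ w → 0# ≤ w ∙ (X t *ᵥ w)
    0≤form {t} jt 0<t below w = decidable-stable (0# ≤? q t) λ q≱0 →
      let q<0 = ≰⇒> q≱0
          ε , 0<ε , ε<-q = smaller (0# - q t) (<⇒0< q<0)
          δ , 0<δ , close = form-continuous (t , jt) w ε 0<ε
          s , 0≤s , s<t , t-s<δ = approach-from-below 0<t 0<δ
          js = downClosed 0≤s (<⇒≤ s<t) jt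
          qs-qt≤ε = ≤-trans (x≤∣x∣ (q s - q t))
            (close (s , js) (<-respˡ (sym (trans (∣x-y∣≈∣y-x∣ s t) (0≤⇒∣x∣≈x (≤⇒0≤ (<⇒≤ s<t))))) t-s<δ))
          0<qs = below s 0≤s s<t w λ w≋0 → <-irrefl (trans (∙-comm w (X t *ᵥ w)) (∙-zeroʳ (X t *ᵥ w) w≋0)) q<0
      in ≤⇒≯ qs-qt≤ε (<-trans ε<-q (+-monoˡ-< (- q t) 0<qs))
      where
      q : Carrier → Carrier
      q s = w ∙ (X s *ᵥ w)

    module _ {v : Vector Carrier n} {t : Carrier} (jt : J t) (Xv≋0 : X t *ᵥ v ≋ 0ᵥ) where

      τ : ∃ J
      τ = t , jt

      open Germ {J} τ

      -- By the symmetry of X the i-th component of Ẋv is -(T_i · Xv). The components of Xv are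
      -- written v·X_i to fit `derivative-∙`, where the constant vector stands on the left.
      u′-bound : ∀ d {L U} → ∥ T d ∥ₘ ≤ L → 0# ≤ U → (∀ i → ∣ v ∙ X (proj₁ d) i ∣ ≤ U) →
        ∀ i → ∣ v ∙ Ẋ (proj₁ d) i ∣ ≤ L * U
      u′-bound d {L} {U} T≤L 0≤U u≤U i = ≤-trans (≈⇒≤ (∣∣-cong v∙Ẋᵢ≈)) (≤-trans (∣-x∣≤∣x∣ (T d i ∙ (Xₜ *ᵥ v)))
        (≤-trans (∣sum∣≤ (λ p → T d i p * (Xₜ *ᵥ v) p))
        (≤-trans (sum-mono λ p → ≤-trans (∣xy∣≤ (T d i p) ((Xₜ *ᵥ v) p))
            (*-monoʳ-≤ (0≤∣x∣ (T d i p)) (≤-trans (≈⇒≤ (∣∣-cong (∙-comm (Xₜ p) v))) (u≤U p))))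
        (≤-trans (≈⇒≤ (sym (*-distribʳ-sum U (λ p → ∣ T d i p ∣))))
          (*-monoˡ-≤ 0≤U (≤-trans (term≤sum (λ i → 0≤∥ T d i ∥) i) T≤L))))))
        where
        Xₜ = X (proj₁ d)
        v∙Ẋᵢ≈ : v ∙ Ẋ (proj₁ d) i ≈ - (T d i ∙ (Xₜ *ᵥ v))
        v∙Ẋᵢ≈ = trans (∙-cong {u = v} (λ _ → refl) (Ẋ≈ d i)) (trans (∙-negʳ v (λ j → Xₜ j ∙ T d i))
          (-‿cong (∙-symmetric (X-symmetric symX₀ (proj₁ d) (proj₂ d)) v (T d i))))

      -- Backward uniqueness for the components of Xv on a window ending at t: the bound on `T` is
      -- the Lipschitz constant, and the bound on Xv ensures that the supremum of its components
      -- exists.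
      kernel-backward : 0# < t → ∃[ s ] 0# ≤ s × s < t × X s *ᵥ v ≋ 0ᵥ
      kernel-backward 0<t =
        let B , T≤B = T-bounded τ
            V , Xv≤V = Xv-bounded τ v
            δ , 0<δ , bounds = near-map₂ {P = λ d → ∣ ∥ T d ∥ₘ ∣ ≤ B} {Q = λ d → ∣ ∥ X (proj₁ d) *ᵥ v ∥ ∣ ≤ V}
              (λ d p q → p , q) T≤B Xv≤V
            L = ∣ B ∣
            h , 0<h , h+h≈1 = halve 1# 0<1
            -- A window shorter than k has length times L at most 1/2, as `backward-uniqueness`
            -- requires; shorter than δ, it lies where both bounds hold.
            k , 0<k , kL≤h = shrink L (0≤∣x∣ B) 0<h
            e , e≤δ , e≤k , 0<e = minimum δ k
            s , 0≤s , s<t , t-s<e = approach-from-below 0<t (0<e 0<δ 0<k)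
            inJ = λ r (s≤r : s ≤ r) (r≤t : r ≤ t) → downClosed (≤-trans 0≤s s≤r) r≤t jt
            close = λ r (s≤r : s ≤ r) (r≤t : r ≤ t) → bounds (r , inJ r s≤r r≤t)
              (<-respˡ (sym (trans (∣x-y∣≈∣y-x∣ r t) (0≤⇒∣x∣≈x (≤⇒0≤ r≤t))))
                (≤-<-trans (+-monoʳ-≤ (neg-mono-≤ s≤r)) (<-≤-trans t-s<e e≤δ)))
        in s , 0≤s , s<t , λ i → trans (∙-comm (X s i) v)
          (backward-uniqueness {n} {J} {s} {t} {h} {L} {V} (λ i r → v ∙ X r i) (λ i r → v ∙ Ẋ r i) inJ
            (λ i r s≤r r≤t → derivative-∙ v λ j → differentiable r (inJ r s≤r r≤t) i j)
            (λ i r s≤r r≤t → ≤-trans (≈⇒≤ (∣∣-cong (∙-comm v (X r i)))) (≤-trans (∣vᵢ∣≤∥v∥ (X r *ᵥ v) i)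
              (≤-trans (x≤∣x∣ (∥ X r *ᵥ v ∥)) (proj₂ (close r s≤r r≤t)))))
            (λ {U} r s≤r r≤t u≤U i → u′-bound (r , inJ r s≤r r≤t)
              (≤-trans (x≤∣x∣ (∥ T (r , inJ r s≤r r≤t) ∥ₘ)) (≤-trans (proj₁ (close r s≤r r≤t)) (x≤∣x∣ B)))
              (≤-trans (0≤∣x∣ (v ∙ X r i)) (u≤U i)) u≤U i)
            (0≤∣x∣ B) h+h≈1
            (≤-trans (*-monoˡ-≤ (0≤∣x∣ B) (≤-trans (<⇒≤ t-s<e) e≤k)) kL≤h)
            (λ i → trans (∙-comm v (X t i)) (Xv≋0 i)) i s ≤-refl (<⇒≤ s<t))

    positive-limit : ∀ {t} → J t → 0# < t → (∀ s → 0# ≤ s → s < t → Positive (X s)) → Positive (X t)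
    positive-limit {t} jt 0<t below v v≉0 = decidable-stable (0# <? v ∙ (X t *ᵥ v)) λ q≯0 →
      let Xv≋0 = semidefinite-kernel (X-symmetric symX₀ t jt) (0≤form jt 0<t below) v (≮⇒≥ q≯0)
          s , 0≤s , s<t , Xₛv≋0 = kernel-backward jt Xv≋0 0<t
      in 0<⇒≉0 (below s 0≤s s<t v v≉0) (∙-zeroʳ v Xₛv≋0)

    -- `X` is an arbitrary function on a setoid. It respects `_≈_` on `J` because the derivative
    -- estimate at t covers s ≈ t, where its right-hand side vanishes.
    X-cong : ∀ {s t} → J s → J t → s ≈ t → ∀ i j → X s i j ≈ X t i j
    X-cong {s} {t} js jt s≈t i j =
      let δ , 0<δ , L = lipschitz-near (differentiable t jt i j) ≤-refl 0<1
          ∣s-t∣≈0 = trans (∣∣-cong (trans (+-congʳ s≈t) (-‿inverseʳ t))) (0≤⇒∣x∣≈x ≤-refl)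
      in x-y≈0⇒x≈y (∣x∣≤0⇒x≈0 (≤-trans (L s js (<-respˡ (sym ∣s-t∣≈0) 0<δ)) (≈⇒≤ (trans (*-congˡ ∣s-t∣≈0) (zeroʳ _)))))

    -- Replacing X(t) by X(s) changes the form at v by at most ε ∥ v ∥², and ε is below the
    -- coercivity constant c. The neighbourhood thus does not depend on v.
    positive-near : ∀ {t} (jt : J t) → Positive (X t) → Germ.Near {J} (t , jt) (λ d → Positive (X (proj₁ d)))
    positive-near {t} jt pos =
      let c , 0<c , coerc = coercive (X t) (X-symmetric symX₀ t jt) pos
          ε , 0<ε , ε<c = smaller c 0<c
      in near-map (λ d close v v≉0 → bound c ε ε<c coerc (proj₁ d) v v≉0
           (≤-trans (x≤∣x∣ (∥ X (proj₁ d) -ₘ X t ∥ₘ)) close))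
           (X-difference-small (t , jt) ε 0<ε)
      where
      open Germ {J} (t , jt)
      bound : ∀ c ε → ε < c → (∀ v → c * (∥ v ∥ * ∥ v ∥) ≤ v ∙ (X t *ᵥ v)) →
        ∀ s v → ¬ (v ≋ 0ᵥ) → ∥ X s -ₘ X t ∥ₘ ≤ ε → 0# < v ∙ (X s *ᵥ v)
      bound c ε ε<c coerc s v v≉0 close = <-≤-trans (*-pos (<⇒0< ε<c) (*-pos 0<∥v∥ 0<∥v∥))
        (0≤⇒≤ (0≤+ (≤⇒0≤ (coerc v)) (≤⇒0≤ perturbation)) (trans (regroup c ε (N * N) q₀ p) (+-congʳ (sym q≈))))
        where
        N = ∥ v ∥
        q₀ = v ∙ (X t *ᵥ v)
        p = v ∙ ((X s -ₘ X t) *ᵥ v)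
        0<∥v∥ : 0# < ∥ v ∥
        0<∥v∥ = ≰⇒> λ ∥v∥≤0 → v≉0 (∥v∥≤0⇒v≋0 v ∥v∥≤0)
        q≈ : v ∙ (X s *ᵥ v) ≈ q₀ + p
        q≈ = trans (split (v ∙ (X s *ᵥ v)) q₀) (+-congˡ (sym (trans
          (∙-cong {u = v} (λ _ → refl) (-ₘ-*ᵥ (X s) (X t) v))
          (∙-∸ʳ v (X s *ᵥ v) (X t *ᵥ v)))))
          where
          split : ∀ a b → a ≈ b + (a - b)
          split = solve 2 (λ a b → a := b :+ (a :- b)) refl
        perturbation : - p ≤ ε * (N * N)
        perturbation = ≤-trans (-x≤∣x∣ p) (≤-trans (∣∙∣≤ v ((X s -ₘ X t) *ᵥ v))
          (≤-trans (*-monoʳ-≤ 0≤∥ v ∥ (≤-trans (∥*ᵥ∥≤ (X s -ₘ X t) v) (*-monoˡ-≤ 0≤∥ v ∥ close)))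
            (≈⇒≤ (reorder N ε))))
          where
          reorder : ∀ N ε → N * (ε * N) ≈ ε * (N * N)
          reorder = solve 2 (λ N ε → N :* (ε :* N) := ε :* (N :* N)) refl
        regroup : ∀ c ε M q p → q - c * M + (ε * M - - p) ≈ q + p - (c - ε) * M
        regroup = solve 5 (λ c ε M q p → q :- c :* M :+ (ε :* M :- :- p) := q :+ p :- (c :- ε) :* M) refl

    X-positive : ∀ t → J t → Positive (X t)
    X-positive t jt = realInduction (λ s → Positive (X s))
      -- `Positive` quantifies over all vectors, but each inequality in it is decidable, so the
      -- double negation is removed vector by vector.
      (λ s ¬¬pos v v≉0 → decidable-stable (0# <? v ∙ (X s *ᵥ v)) λ q≯0 → ¬¬pos λ pos → q≯0 (pos v v≉0))
      (nonneg jt) closed ahead t (nonneg jt) ≤-refl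
      where
      closed : ∀ τ → 0# ≤ τ → τ ≤ t → (∀ s → 0# ≤ s → s < τ → Positive (X s)) → Positive (X τ)
      closed τ (inj₁ 0<τ) τ≤t below = positive-limit (downClosed (<⇒≤ 0<τ) τ≤t jt) 0<τ below
      -- At the initial time there is nothing to take a limit of; definiteness is transported from
      -- `X 0#` along 0 ≈ τ.
      closed τ (inj₂ 0≈τ) τ≤t below v v≉0 = <-respʳ
        (∙-cong {u = v} (λ _ → refl) (*ᵥ-congʳ v (X-cong start (downClosed (inj₂ 0≈τ) τ≤t jt) 0≈τ)))
        (posX₀ v v≉0)
      ahead : ∀ τ → 0# ≤ τ → τ < t → Positive (X τ) →
        ∃[ δ ] 0# < δ × (∀ s → τ < s → s ≤ t → s - τ < δ → Positive (X s))
      ahead τ 0≤τ τ<t pos = let δ , 0<δ , near = positive-near (downClosed 0≤τ (<⇒≤ τ<t) jt) pos in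
        δ , 0<δ , λ s τ<s s≤t s-τ<δ → near (s , downClosed (≤-trans 0≤τ (<⇒≤ τ<s)) s≤t jt)
          (<-respˡ (sym (0≤⇒∣x∣≈x (≤⇒0≤ (<⇒≤ τ<s)))) s-τ<δ)

theorem5p2 : (ℝ : RealField) → let open OverReals ℝ in
    ∀ (m n : ℕ)
    (C : Matrix n n) (A : Fin m → Matrix n n) (b : Vector Carrier m) →
    PositiveDefinite C →
    (∀ ℓ → IsSymmetric (A ℓ)) →
    LinearlyIndependent A →
    (J : Carrier → Set) → IsTimeInterval J →
    (X : Carrier → Matrix n n) →
    IsSolution C A J X →
    PositiveDefinite (X 0#) →
    LinearlyFeasible A b (X 0#) →
    ∀ t → J t → PositiveDefinite (X t) × LinearlyFeasible A b (X t)
theorem5p2 ℝ m n C A b (symC , _) symA _ J interval X solution (symX₀ , posX₀) feasible₀ t jt =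
  (X-symmetric symX₀ t jt , X-positive t jt) , λ ℓ → trans (𝒜vecX-constant t jt ℓ) (feasible₀ ℓ)
  where
  open CommutativeRing (RealField.commutativeRing ℝ) using (trans)
  open Analysis.AnsatzFlow ℝ symC symA interval solution
  open Analysis.Positivity ℝ symC symA interval solution symX₀ posX₀
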